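{- Let $S$ be a metric signature, let $L$ be a countable fragment of $\mathcal{L}_{\omega_1,\omega}(S)$ (the $[0,1]$-valued infinitary logic for metric structures), and let $T$ be an $L$-theory. For each $n<\omega$ let $\Sigma_n$ be a type of $T$, in finitely many variables (the number of variables may depend on $n$), that is not principal over $T$. Then there is a model $\mathcal{M}$ of $T$ that omits every $\Sigma_n$, i.e. for every $n$ no tuple of elements of $\mathcal{M}$ realizes $\Sigma_n$.
   Context: Metric structures. A metric structure $\mathcal{M}$ consists of a metric space $(M,d)$ with $d\le 1$ (not necessarily complete), together with sets of uniformly continuous functions $M^n\to M$, of uniformly continuous predicates $M^n\to[0,1]$, and of distinguished elements; $M^n$ carries the sup metric. A metric signature $S$ consists of function symbols and predicate symbols, each with an arity and a modulus of continuity $\delta:\mathbb{Q}\cap(0,1)\to\mathbb{Q}\cap(0,1)$, and constant symbols. An $S$-structure interprets each symbol respecting its modulus: $\sup_i d(a_i,b_i)<\delta(\epsilon)$ implies $d(f(\bar a),f(\bar b))\le\epsilon$ for function symbols, resp. $|P(\bar a)-P(\bar b)|\le\epsilon$ for predicate symbols. Formulas. Terms are as in first-order logic. Atomic formulas: $d(t_1,t_2)$ and $P(t_1,\dots,t_n)$ for terms $t_i$. Formulas of $\mathcal{L}_{\omega_1,\omega}(S)$ are built from atomic formulas and constants $q\in\mathbb{Q}\cap[0,1]$ by $\varphi\to\psi$, by $\sup_x\varphi$, and by $\sup_{n<\omega}\varphi_n$ when the total number of free variables in all $\varphi_n$ is finite. Truth values $\varphi^{\mathcal{M}}(\bar a)\in[0,1]$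 are defined by recursion: atomic formulas and constants in the obvious way, $(\psi\to\theta)^{\mathcal M}=\min\{1-\psi^{\mathcal M}+\theta^{\mathcal M},1\}$, and $\sup_{n}$, $\sup_x$ are suprema over $n<\omega$ and over $x\in M$. $\mathcal{M}\models\varphi(\bar a)$ means $\varphi^{\mathcal M}(\bar a)=1$. Abbreviation: $\neg\varphi=(\varphi\to 0)$, with value $1-\varphi$. For rational $r$, "$\varphi\ge r$" is the formula $r\to\varphi$. Fragments. A fragment of $\mathcal{L}_{\omega_1,\omega}(S)$ is a set $L$ of $\mathcal{L}_{\omega_1,\omega}(S)$-formulas that contains every atomic formula and every constant formula $q\in\mathbb{Q}\cap[0,1]$, is closed under $\sup_x$, $\to$ and $\neg$, and is closed under substituting terms for variables. An $L$-theory is a set of $L$-sentences; a model of $T$ is an $S$-structure satisfying every sentence of $T$. Types. A set $\Sigma(x_1,\dots,x_n)$ of $L$-formulas is a type of $T$ if it is realized in some model of $T$: there are $\mathcal{M}\models T$ and $a_1,\dots,a_n\in M$ with $\mathcal{M}\models\varphi(a_1,\dots,a_n)$ for all $\varphi\in\Sigma$. A type $\Sigma(x_1,\dots,x_n)$ of $T$ is principal over $T$ if there are an $L$-formula $\varphi(\bar y)$, terms $t_1(\bar y),\dots,t_n(\bar y)$ (with $\bar y$ a finite tuple of variables) and $r\in\mathbb{Q}\cap(0,1)$ such that (i) $T\cup\{\varphi(\bar y)\}$ is satisfiable, i.e. there are $\mathcal M\models T$ and $\bar b$ in $M$ with $\varphi^{\mathcal M}(\bar b)=1$; and (ii) $T\cup\{\varphi(\bar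 y)\ge r\}\models\Sigma(t_1(\bar y),\dots,t_n(\bar y))$, i.e. for all $\mathcal{M}\models T$ and $\bar b$ in $M$ with $\varphi^{\mathcal M}(\bar b)\ge r$, the tuple $(t_1^{\mathcal M}(\bar b),\dots,t_n^{\mathcal M}(\bar b))$ realizes $\Sigma$.
   Formalization: The fragment L is additionally required to be closed under subformulas (the standard definition); with only the closure properties listed the claim is false. Structures are taken to be nonempty. -}

module Defs where

open import Level using (0ℓ)
open import Data.Fin.Base using (Fin)
open import Data.Fin.Substitution using (Sub; Simple)
open import Data.Nat.Base using (ℕ; suc)
open import Data.Product using (Σ-syntax; ∃-syntax; _×_; _,_; proj₁; proj₂)
open import Data.Rational.Base as ℚ using (ℚ; 0ℚ; 1ℚ)
import Data.Rational.Properties as ℚₚ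
open import Data.Sum.Base using (_⊎_; inj₁; inj₂; [_,_]′)
open import Data.Vec.Base using (Vec; []; _∷_; lookup)
import Function.Metric.Structures as Metric
open import Relation.Binary.PropositionalEquality using (_≡_; refl; sym; trans; cong; subst)
open import Relation.Binary.Structures using (IsPartialOrder)
open import Relation.Unary using (Pred; _∈_; _∉_; _⊆_)

-- Real numbers are Dedekind lower cuts, `p ∈ lower x` meaning "p < x".  No
-- upper cut and no locatedness is demanded, so this is the textbook ℝ when read
-- classically, and arbitrary bounded suprema can be formed without any axiom.
-- Equality of reals is _≈_, not _≡_.

record ℝ : Set₁ where
  field
    lower      : Pred ℚ 0ℓ
    inhabited  : ∃[ p ] p ∈ lower
    bounded    : ∃[ p ] p ∉ lower
    downClosed : ∀ {p q} → p ℚ.≤ q → q ∈ lower → p ∈ lower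
    open′      : ∀ {p} → p ∈ lower → ∃[ q ] (p ℚ.< q × q ∈ lower)

open ℝ public

infix  4 _≤_ _<_ _≈_
infixl 6 _+_ _-_
infixl 7 _⊓_
infixl 6 _⊔_
infix  8 -_

_≤_ : ℝ → ℝ → Set
x ≤ y = lower x ⊆ lower y

_≈_ : ℝ → ℝ → Set
x ≈ y = x ≤ y × y ≤ x

_<_ : ℝ → ℝ → Set
x < y = ∃[ p ] (p ∉ lower x × p ∈ lower y)

≤-isPartialOrder : IsPartialOrder _≈_ _≤_
≤-isPartialOrder = record
  { isPreorder = record
    { isEquivalence = record
      { refl  = (λ p → p) , (λ p → p)
      ; sym   = λ (a , b) → b , a
      ; trans = λ (a , b) (c , d) → (λ p → c (a p)) , (λ p → b (d p))
      }
    ; reflexive = proj₁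
    ; trans     = λ a b p → b (a p)
    }
  ; antisym = λ a b → a , b
  }

private
  pred-ℚ : ∀ p → p ℚ.- 1ℚ ℚ.< p
  pred-ℚ p = subst (p ℚ.- 1ℚ ℚ.<_) (ℚₚ.+-identityʳ p)
    (ℚₚ.+-monoʳ-< p (ℚₚ.neg-antimono-< {0ℚ} {1ℚ} (ℚₚ.positive⁻¹ 1ℚ)))

  below-outside : ∀ (x : ℝ) {p q} → p ∈ lower x → q ∉ lower x → p ℚ.< q
  below-outside x p∈ q∉ = ℚₚ.≰⇒> (λ q≤p → q∉ (downClosed x q≤p p∈))

  cancel : ∀ r s → s ℚ.+ (r ℚ.- s) ≡ r
  cancel r s = trans (ℚₚ.+-comm s (r ℚ.- s))
    (trans (ℚₚ.+-assoc r (ℚ.- s) s)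
      (trans (cong (r ℚ.+_) (ℚₚ.+-inverseˡ s)) (ℚₚ.+-identityʳ r)))

fromℚ : ℚ → ℝ
fromℚ r = record
  { lower      = λ p → p ℚ.< r
  ; inhabited  = r ℚ.- 1ℚ , pred-ℚ r
  ; bounded    = r , ℚₚ.<-irrefl refl
  ; downClosed = ℚₚ.≤-<-trans
  ; open′      = λ p<r → let q , p<q , q<r = ℚₚ.<-dense p<r in q , p<q , q<r
  }

0ℝ 1ℝ : ℝ
0ℝ = fromℚ 0ℚ
1ℝ = fromℚ 1ℚ

_+_ : ℝ → ℝ → ℝ
x + y = record
  { lower      = λ p → ∃[ a ] ∃[ b ] (a ∈ lower x × b ∈ lower y × p ℚ.< a ℚ.+ b)
  ; inhabited  = let a , a∈ = inhabited x ; b , b∈ = inhabited y in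
                 a ℚ.+ b ℚ.- 1ℚ , a , b , a∈ , b∈ , pred-ℚ (a ℚ.+ b)
  ; bounded    = let u , u∉ = bounded x ; v , v∉ = bounded y in
                 u ℚ.+ v , λ (a , b , a∈ , b∈ , lt) → ℚₚ.<-asym lt
                   (ℚₚ.+-mono-< (below-outside x a∈ u∉) (below-outside y b∈ v∉))
  ; downClosed = λ p≤q (a , b , a∈ , b∈ , lt) → a , b , a∈ , b∈ , ℚₚ.≤-<-trans p≤q lt
  ; open′      = λ (a , b , a∈ , b∈ , lt) → let q , p<q , q< = ℚₚ.<-dense lt in
                 q , p<q , a , b , a∈ , b∈ , q<
  }

-_ : ℝ → ℝ
- x = record
  { lower      = λ p → ∃[ u ] (u ∉ lower x × p ℚ.< ℚ.- u)
  ; inhabited  = let u , u∉ = bounded x in ℚ.- u ℚ.- 1ℚ , u , u∉ , pred-ℚ (ℚ.- u)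
  ; bounded    = let a , a∈ = inhabited x in ℚ.- a , λ (u , u∉ , lt) →
                 ℚₚ.<-asym lt (ℚₚ.neg-antimono-< (below-outside x a∈ u∉))
  ; downClosed = λ p≤q (u , u∉ , lt) → u , u∉ , ℚₚ.≤-<-trans p≤q lt
  ; open′      = λ (u , u∉ , lt) → let q , p<q , q< = ℚₚ.<-dense lt in q , p<q , u , u∉ , q<
  }

_-_ : ℝ → ℝ → ℝ
x - y = x + (- y)

_⊓_ : ℝ → ℝ → ℝ
x ⊓ y = record
  { lower      = λ p → p ∈ lower x × p ∈ lower y
  ; inhabited  = let a , a∈ = inhabited x ; b , b∈ = inhabited y in
                 a ℚ.⊓ b , downClosed x (ℚₚ.p⊓q≤p a b) a∈ , downClosed y (ℚₚ.p⊓q≤q a b) b∈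
  ; bounded    = let u , u∉ = bounded x in u , λ (u∈ , _) → u∉ u∈
  ; downClosed = λ p≤q (l , r) → downClosed x p≤q l , downClosed y p≤q r
  ; open′      = λ {p} (l , r) →
                 let a , p<a , a∈ = open′ x l ; b , p<b , b∈ = open′ y r in
                 a ℚ.⊓ b ,
                 [ (λ eq → subst (p ℚ.<_) (sym eq) p<a) , (λ eq → subst (p ℚ.<_) (sym eq) p<b) ]′
                   (ℚₚ.⊓-sel a b) ,
                 downClosed x (ℚₚ.p⊓q≤p a b) a∈ , downClosed y (ℚₚ.p⊓q≤q a b) b∈
  }

_⊔_ : ℝ → ℝ → ℝ
x ⊔ y = record
  { lower      = λ p → p ∈ lower x ⊎ p ∈ lower y
  ; inhabited  = let a , a∈ = inhabited x in a , inj₁ a∈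
  ; bounded    = let u , u∉ = bounded x ; v , v∉ = bounded y in
                 u ℚ.⊔ v , [ (λ m → u∉ (downClosed x (ℚₚ.p≤p⊔q u v) m))
                           , (λ m → v∉ (downClosed y (ℚₚ.p≤q⊔p u v) m)) ]′
  ; downClosed = λ p≤q → [ (λ m → inj₁ (downClosed x p≤q m)) , (λ m → inj₂ (downClosed y p≤q m)) ]′
  ; open′      = [ (λ m → let q , p<q , q∈ = open′ x m in q , p<q , inj₁ q∈)
                 , (λ m → let q , p<q , q∈ = open′ y m in q , p<q , inj₂ q∈) ]′
  }

∣_∣ : ℝ → ℝ
∣ x ∣ = x ⊔ (- x)

record 𝕀 : Set₁ where
  field
    val   : ℝ
    0≤val : 0ℝ ≤ val
    val≤1 : val ≤ 1ℝ

open 𝕀 public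

record ℚ[0,1] : Set where
  constructor mk
  field
    rat   : ℚ
    0≤rat : 0ℚ ℚ.≤ rat
    rat≤1 : rat ℚ.≤ 1ℚ

record ℚ⟨0,1⟩ : Set where
  constructor mk
  field
    rat   : ℚ
    0<rat : 0ℚ ℚ.< rat
    rat<1 : rat ℚ.< 1ℚ

real : ℚ⟨0,1⟩ → ℝ
real r = fromℚ (ℚ⟨0,1⟩.rat r)

fromℚ[0,1] : ℚ[0,1] → 𝕀
fromℚ[0,1] (mk r 0≤r r≤1) = record
  { val   = fromℚ r
  ; 0≤val = λ p<0 → ℚₚ.<-≤-trans p<0 0≤r
  ; val≤1 = λ p<r → ℚₚ.<-≤-trans p<r r≤1
  }

-- Supremum in [0,1]; the first disjunct makes the supremum of the empty family 0.
⋁ : {I : Set} → (I → 𝕀) → 𝕀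
⋁ f = record
  { val = record
    { lower      = λ p → p ℚ.< 0ℚ ⊎ ∃[ i ] p ∈ lower (val (f i))
    ; inhabited  = 0ℚ ℚ.- 1ℚ , inj₁ (pred-ℚ 0ℚ)
    ; bounded    = 1ℚ , [ (λ 1<0 → ℚₚ.<-asym 1<0 (ℚₚ.positive⁻¹ 1ℚ))
                        , (λ (i , m) → ℚₚ.<-irrefl refl (val≤1 (f i) m)) ]′
    ; downClosed = λ p≤q → [ (λ q<0 → inj₁ (ℚₚ.≤-<-trans p≤q q<0))
                           , (λ (i , m) → inj₂ (i , downClosed (val (f i)) p≤q m)) ]′
    ; open′      = [ (λ p<0 → let q , p<q , q<0 = ℚₚ.<-dense p<0 in q , p<q , inj₁ q<0)
                   , (λ (i , m) → let q , p<q , q∈ = open′ (val (f i)) m in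
                                  q , p<q , inj₂ (i , q∈)) ]′
    }
  ; 0≤val = inj₁
  ; val≤1 = [ (λ p<0 → ℚₚ.<-trans p<0 (ℚₚ.positive⁻¹ 1ℚ)) , (λ (i , m) → val≤1 (f i) m) ]′
  }

private
  0≤x+y : ∀ x y → 0ℝ ≤ x → 0ℝ ≤ y → 0ℝ ≤ x + y
  0≤x+y x y 0≤x 0≤y {p} p<0 =
    let s , p<s , s<0 = ℚₚ.<-dense p<0
        r , p<r , r<s = ℚₚ.<-dense p<s
    in s , r ℚ.- s , 0≤x s<0
     , 0≤y (subst (r ℚ.- s ℚ.<_) (ℚₚ.+-inverseʳ s) (ℚₚ.+-monoˡ-< (ℚ.- s) r<s))
     , subst (p ℚ.<_) (sym (cancel r s)) p<r

  0≤1-x : ∀ x → x ≤ 1ℝ → 0ℝ ≤ 1ℝ - x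
  0≤1-x x x≤1 {p} p<0 =
    let s , p<s , s<0 = ℚₚ.<-dense p<0
        r , p<r , r<s = ℚₚ.<-dense p<s
    in 1ℚ ℚ.+ s , ℚ.- 1ℚ ℚ.+ (r ℚ.- s)
     , subst (1ℚ ℚ.+ s ℚ.<_) (ℚₚ.+-identityʳ 1ℚ) (ℚₚ.+-monoʳ-< 1ℚ s<0)
     , (1ℚ , (λ m → ℚₚ.<-irrefl refl (x≤1 m))
       , subst (ℚ.- 1ℚ ℚ.+ (r ℚ.- s) ℚ.<_) (ℚₚ.+-identityʳ (ℚ.- 1ℚ))
           (ℚₚ.+-monoʳ-< (ℚ.- 1ℚ)
             (subst (r ℚ.- s ℚ.<_) (ℚₚ.+-inverseʳ s) (ℚₚ.+-monoˡ-< (ℚ.- s) r<s))))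
     , subst (p ℚ.<_) (sym (lemma r s)) p<r
    where
    lemma : ∀ r s → 1ℚ ℚ.+ s ℚ.+ (ℚ.- 1ℚ ℚ.+ (r ℚ.- s)) ≡ r
    lemma r s =
      trans (cong (ℚ._+ (ℚ.- 1ℚ ℚ.+ (r ℚ.- s))) (ℚₚ.+-comm 1ℚ s))
      (trans (ℚₚ.+-assoc s 1ℚ _)
      (trans (cong (s ℚ.+_) (sym (ℚₚ.+-assoc 1ℚ (ℚ.- 1ℚ) (r ℚ.- s))))
      (trans (cong (s ℚ.+_) (ℚₚ.+-identityˡ (r ℚ.- s))) (cancel r s))))

_⇛_ : 𝕀 → 𝕀 → 𝕀
x ⇛ y = record
  { val   = (1ℝ - val x + val y) ⊓ 1ℝ
  ; 0≤val = λ p<0 → 0≤x+y (1ℝ - val x) (val y) (0≤1-x (val x) (val≤1 x)) (0≤val y) p<0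
                  , ℚₚ.<-trans p<0 (ℚₚ.positive⁻¹ 1ℚ)
  ; val≤1 = proj₂
  }

Modulus : Set
Modulus = ℚ⟨0,1⟩ → ℚ⟨0,1⟩

record Signature : Set₁ where
  field
    Func      : Set
    funArity  : Func → ℕ
    funMod    : Func → Modulus
    PredSym   : Set
    predArity : PredSym → ℕ
    predMod   : PredSym → Modulus
    Const     : Set

record Structure (S : Signature) : Set₁ where
  open Signature S
  field
    Carrier  : Set
    nonempty : Carrier
    dist     : Carrier → Carrier → 𝕀
    isMetric : Metric.IsGeneralMetric _≡_ _≈_ _≤_ 0ℝ _+_ (λ a b → val (dist a b))

  supDist : ∀ {k} → Vec Carrier k → Vec Carrier k → ℝ
  supDist as bs = val (⋁ (λ i → dist (lookup as i) (lookup bs i)))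

  field
    funI  : (f : Func) → Vec Carrier (funArity f) → Carrier
    predI : (P : PredSym) → Vec Carrier (predArity P) → 𝕀
    conI  : Const → Carrier
    funI-modulus : ∀ f ε as bs → supDist as bs < real (funMod f ε) →
                   val (dist (funI f as) (funI f bs)) ≤ real ε
    predI-modulus : ∀ P ε as bs → supDist as bs < real (predMod P ε) →
                    ∣ val (predI P as) - val (predI P bs) ∣ ≤ real ε

module _ (S : Signature) where
  open Signature S

  data Term (n : ℕ) : Set where
    var : Fin n → Term n
    con : Const → Term n
    app : (f : Func) → Vec (Term n) (funArity f) → Term n

  infixr 5 _⇒_

  -- Formula n: formulas with free variables among n (de Bruijn indices).
  -- A countable supremum is over formulas in one common finite context.
  data Formula (n : ℕ) : Set where
    distF : Term n → Term n → Formula n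
    predF : (P : PredSym) → Vec (Term n) (predArity P) → Formula n
    const : ℚ[0,1] → Formula n
    _⇒_   : Formula n → Formula n → Formula n
    supX  : Formula (suc n) → Formula n
    supN  : (ℕ → Formula n) → Formula n

module _ {S : Signature} where
  open Signature S

  mutual
    renameTerm : ∀ {m n} → (Fin m → Fin n) → Term S m → Term S n
    renameTerm ρ (var i)    = var (ρ i)
    renameTerm ρ (con c)    = con c
    renameTerm ρ (app f ts) = app f (renameTerms ρ ts)

    renameTerms : ∀ {m n k} → (Fin m → Fin n) → Vec (Term S m) k → Vec (Term S n) k
    renameTerms ρ []       = []
    renameTerms ρ (t ∷ ts) = renameTerm ρ t ∷ renameTerms ρ ts

  simple : Simple (Term S)
  simple = record { var = var ; weaken = renameTerm Fin.suc }

  open Simple simple using (_↑)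

  mutual
    substTerm : ∀ {m n} → Sub (Term S) m n → Term S m → Term S n
    substTerm σ (var i)    = lookup σ i
    substTerm σ (con c)    = con c
    substTerm σ (app f ts) = app f (substTerms σ ts)

    substTerms : ∀ {m n k} → Sub (Term S) m n → Vec (Term S m) k → Vec (Term S n) k
    substTerms σ []       = []
    substTerms σ (t ∷ ts) = substTerm σ t ∷ substTerms σ ts

  substFormula : ∀ {m n} → Sub (Term S) m n → Formula S m → Formula S n
  substFormula σ (distF s t)  = distF (substTerm σ s) (substTerm σ t)
  substFormula σ (predF P ts) = predF P (substTerms σ ts)
  substFormula σ (const q)    = const q
  substFormula σ (φ ⇒ ψ)      = substFormula σ φ ⇒ substFormula σ ψ
  substFormula σ (supX φ)     = supX (substFormula (σ ↑) φ)
  substFormula σ (supN φs)    = supN (λ k → substFormula σ (φs k))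

  infix 9 ¬F_

  ¬F_ : ∀ {n} → Formula S n → Formula S n
  ¬F φ = φ ⇒ const (mk 0ℚ ℚₚ.≤-refl (ℚₚ.nonNegative⁻¹ 1ℚ))

  infix 4 _≅_

  -- Identity of formulas.  It differs from _≡_ only in comparing the sequences
  -- under supN pointwise, function extensionality not being available.
  data _≅_ {n : ℕ} : Formula S n → Formula S n → Set where
    distF : ∀ {s t} → distF s t ≅ distF s t
    predF : ∀ {P ts} → predF P ts ≅ predF P ts
    const : ∀ {q} → const q ≅ const q
    _⇒_   : ∀ {φ φ′ ψ ψ′} → φ ≅ φ′ → ψ ≅ ψ′ → (φ ⇒ ψ) ≅ (φ′ ⇒ ψ′)
    supX  : ∀ {φ φ′} → φ ≅ φ′ → supX φ ≅ supX φ′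
    supN  : ∀ {φs φs′} → (∀ k → φs k ≅ φs′ k) → supN φs ≅ supN φs′

  module _ (𝓜 : Structure S) where
    open Structure 𝓜

    mutual
      evalTerm : ∀ {n} → Vec Carrier n → Term S n → Carrier
      evalTerm as (var i)    = lookup as i
      evalTerm as (con c)    = conI c
      evalTerm as (app f ts) = funI f (evalTerms as ts)

      evalTerms : ∀ {n k} → Vec Carrier n → Vec (Term S n) k → Vec Carrier k
      evalTerms as []       = []
      evalTerms as (t ∷ ts) = evalTerm as t ∷ evalTerms as ts

    eval : ∀ {n} → Formula S n → Vec Carrier n → 𝕀
    eval (distF s t)  as = dist (evalTerm as s) (evalTerm as t)
    eval (predF P ts) as = predI P (evalTerms as ts)
    eval (const q)    as = fromℚ[0,1] q
    eval (φ ⇒ ψ)      as = eval φ as ⇛ eval ψ as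
    eval (supX φ)     as = ⋁ (λ a → eval φ (a ∷ as))
    eval (supN φs)    as = ⋁ (λ k → eval (φs k) as)

    Satisfies : ∀ {n} → Formula S n → Vec Carrier n → Set
    Satisfies φ as = val (eval φ as) ≈ 1ℝ

    Realizes : ∀ {n} → Pred (Formula S n) 0ℓ → Vec Carrier n → Set
    Realizes Σ as = ∀ {φ} → φ ∈ Σ → Satisfies φ as

    IsModel : Pred (Formula S 0) 0ℓ → Set
    IsModel T = ∀ {φ} → φ ∈ T → Satisfies φ []

-- Closure under subformulas (the last four fields) is part of the usual notion of
-- a fragment, and omitting types fails without it: let T say that P₀, P₁, … are
-- {0,1}-valued, that d is discrete and that every finite Boolean cell is infinite,
-- and add the sentence sup_x inf_k P_k(x).  For L the least set containing that
-- sentence and having the other closure properties, {P_k(x) : k < ω} is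
-- non-principal over T and yet realized in every model of T.
record Fragment (S : Signature) : Set₁ where
  field
    formulas  : ∀ n → Pred (Formula S n) 0ℓ
    resp-≅    : ∀ {n} {φ ψ : Formula S n} → φ ≅ ψ → φ ∈ formulas n → ψ ∈ formulas n
    has-distF : ∀ {n} (s t : Term S n) → distF s t ∈ formulas n
    has-predF : ∀ {n} P (ts : Vec (Term S n) (Signature.predArity S P)) → predF P ts ∈ formulas n
    has-const : ∀ {n} q → const q ∈ formulas n
    ⇒-closed  : ∀ {n} {φ ψ : Formula S n} →
                φ ∈ formulas n → ψ ∈ formulas n → (φ ⇒ ψ) ∈ formulas n
    supX-closed : ∀ {n} {φ : Formula S (suc n)} → φ ∈ formulas (suc n) → supX φ ∈ formulas n
    subst-closed : ∀ {m n} (σ : Sub (Term S) m n) {φ} →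
                   φ ∈ formulas m → substFormula σ φ ∈ formulas n
    ⇒-subˡ   : ∀ {n} {φ ψ : Formula S n} → (φ ⇒ ψ) ∈ formulas n → φ ∈ formulas n
    ⇒-subʳ   : ∀ {n} {φ ψ : Formula S n} → (φ ⇒ ψ) ∈ formulas n → ψ ∈ formulas n
    supX-sub : ∀ {n} {φ : Formula S (suc n)} → supX φ ∈ formulas n → φ ∈ formulas (suc n)
    supN-sub : ∀ {n} {φs : ℕ → Formula S n} → supN φs ∈ formulas n → ∀ k → φs k ∈ formulas n

  ¬-closed : ∀ {n} {φ : Formula S n} → φ ∈ formulas n → ¬F φ ∈ formulas n
  ¬-closed φ∈ = ⇒-closed φ∈ (has-const _)

-- Every context's part of the fragment is exhausted, up to _≅_, by a sequence.
Countable : ∀ {S} → Fragment S → Set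
Countable {S} L = ∀ n → Σ[ e ∈ (ℕ → Formula S n) ]
  (∀ {φ} → φ ∈ Fragment.formulas L n → ∃[ k ] e k ≅ φ)

module _ {S : Signature} (L : Fragment S) where
  open Fragment L

  IsTheory : Pred (Formula S 0) 0ℓ → Set
  IsTheory T = T ⊆ formulas 0

  record IsType (T : Pred (Formula S 0) 0ℓ) {n} (Σ : Pred (Formula S n) 0ℓ) : Set₁ where
    field
      isSubset : Σ ⊆ formulas n
      model    : Structure S
      isModel  : IsModel model T
      tuple    : Vec (Structure.Carrier model) n
      realizes : Realizes model Σ tuple

  record Principal (T : Pred (Formula S 0) 0ℓ) {n} (Σ : Pred (Formula S n) 0ℓ) : Set₁ where
    field
      {m} : ℕ
      φ   : Formula S m
      φ∈L : φ ∈ formulas m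
      ts  : Vec (Term S m) n
      r   : ℚ⟨0,1⟩
      satisfiable : Σ[ 𝓜 ∈ Structure S ] (IsModel 𝓜 T × ∃[ bs ] Satisfies 𝓜 φ bs)
      entails : (𝓜 : Structure S) → IsModel 𝓜 T → ∀ bs →
                real r ≤ val (eval 𝓜 φ bs) → Realizes 𝓜 Σ (evalTerms 𝓜 bs ts)

{-# OPTIONS --safe #-}

-- A Henkin construction by forcing.  A condition is a formula γ of L which is positive at some
-- assignment in some model of T, and it forces what holds at every assignment in a model of T
-- making γ positive.  A sequence of stronger and stronger conditions decides all the statements
-- φ > p, provides a witness for every supremum forced to exceed p, and for each Σ_n and each
-- tuple of terms t forces σ(t) ≤ q for some σ ∈ Σ_n and some q < 1.  The last is possible
-- because otherwise s ⇒ γ, where 0 < s < γ at some assignment, would make Σ_n principal with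
-- any threshold in (1 − s, 1): s ⇒ γ attains 1, and above the threshold γ is positive.
-- Terms in countably many variables, identified when their equality is forced, form a model in
-- which φ > p holds iff it is forced.

module Submission where

open import Defs
open import Level using (0ℓ; Lift; lift) renaming (suc to lsuc)
open import Axiom.ExcludedMiddle using (ExcludedMiddle)
import Data.Bool.Base as Bool
open import Data.Bool.Properties using (T-irrelevant)
open import Data.Empty using (⊥; ⊥-elim)
open import Data.Fin.Base using (Fin; zero; suc; toℕ; inject≤) renaming (fromℕ to last)
open import Data.Fin.Properties using (toℕ-inject≤; toℕ-fromℕ; toℕ<n)
open import Data.Fin.Substitution using (Sub)
open import Data.Integer.Base as ℤ using (+_; -[1+_])
import Data.Integer.Properties as ℤₚ
open import Data.Nat.Base as ℕ using (ℕ; zero; suc)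
open import Data.Nat.Induction using (<-wellFounded)
import Data.Nat.Properties as ℕₚ
open import Data.Product using (Σ-syntax; ∃-syntax; _×_; _,_; proj₁; proj₂)
open import Data.Rational.Base as ℚ using (ℚ; 0ℚ; 1ℚ)
import Data.Rational.Properties as ℚₚ
open import Data.Rational.Solver using (module +-*-Solver)
import Data.Rational.Unnormalised.Base as ℚᵘ
import Data.Rational.Unnormalised.Properties as ℚᵘₚ
open import Data.Sum.Base using (_⊎_; inj₁; inj₂)
open import Data.Unit.Base using (tt)
open import Data.Vec.Base using (Vec; []; _∷_; lookup; tabulate; map)
open import Data.Vec.Properties using (tabulate-cong; lookup∘tabulate; lookup-map; map-∘)
open import Function.Base using (_∘_)
import Function.Metric.Structures as Metric
open import Induction.WellFounded using (Acc; acc)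
open import Relation.Binary.PropositionalEquality
  using (_≡_; refl; sym; trans; cong; cong₂; subst; subst₂; isEquivalence)
open import Relation.Nullary using (¬_; Dec; yes; no; does)
open import Relation.Nullary.Decidable using (decidable-stable)
open import Relation.Unary using (Pred; _∈_; _∉_)
open +-*-Solver using (solve; con; _:+_; _:*_; _:-_; :-_; _:=_)

-- Real numbers

infixl 5 _+<_

_+<_ : ∀ {p q r s} → p ℚ.< q → r ℚ.< s → p ℚ.+ r ℚ.< q ℚ.+ s
_+<_ = ℚₚ.+-mono-<

-- Equal differences carry a strict inequality over, so that each estimate reduces to a linear
-- identity left to the ring solver.
<-diff : ∀ {p q r s} → r ℚ.< s → q ℚ.- p ≡ s ℚ.- r → p ℚ.< q
<-diff {p} {q} {r} {s} r<s eq =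
  subst (ℚ._< q) (ℚₚ.+-identityˡ p)
    (subst (0ℚ ℚ.+ p ℚ.<_) (solve 2 (λ p q → q :- p :+ p := q) refl p q)
      (ℚₚ.+-monoˡ-< p
        (subst (0ℚ ℚ.<_) (sym eq)
          (subst (ℚ._< s ℚ.- r) (ℚₚ.+-inverseʳ r) (ℚₚ.+-monoˡ-< (ℚ.- r) r<s)))))

<⇒0<- : ∀ {p q} → p ℚ.< q → 0ℚ ℚ.< q ℚ.- p
<⇒0<- {p} {q} p<q =
  <-diff p<q (solve 2 (λ p q → q :- p :- con 0ℚ := q :- p) refl p q)

fromℕ : ℕ → ℚ
fromℕ zero    = 0ℚ
fromℕ (suc n) = 1ℚ ℚ.+ fromℕ n

toℚᵘ-fromℕ : ∀ n → ℚ.toℚᵘ (fromℕ n) ℚᵘ.≃ ℚᵘ.mkℚᵘ (+ n) 0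
toℚᵘ-fromℕ zero    = ℚᵘₚ.≃-refl
toℚᵘ-fromℕ (suc n) = ℚᵘₚ.≃-trans (ℚₚ.toℚᵘ-homo-+ 1ℚ (fromℕ n))
  (ℚᵘₚ.≃-trans (ℚᵘₚ.+-congʳ (ℚ.toℚᵘ 1ℚ) (toℚᵘ-fromℕ n))
    (ℚᵘ.*≡* (cong (λ m → (+ 1 ℤ.+ m) ℤ.* + 1) (ℤₚ.*-identityʳ (+ n)))))

≤-fromℕ : ∀ p → p ℚ.≤ fromℕ ℤ.∣ ℚ.↥ p ∣
≤-fromℕ p@(ℚ.mkℚ n d _) = ℚₚ.toℚᵘ-cancel-≤
  (ℚᵘₚ.≤-respʳ-≃ (ℚᵘₚ.≃-sym (toℚᵘ-fromℕ ℤ.∣ n ∣)) (ℚᵘ.*≤* (bound n)))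
  where
  bound : ∀ n → n ℤ.* + 1 ℤ.≤ + ℤ.∣ n ∣ ℤ.* + suc d
  bound (+ n)    = ℤₚ.*-monoˡ-≤-nonNeg (+ n) (ℤ.+≤+ (ℕ.s≤s ℕ.z≤n))
  bound -[1+ n ] = ℤ.-≤+

-- The absolute value of the numerator of `d / η` bounds this quotient, a denominator being at least
-- 1.
archimedean : ∀ {η} d → 0ℚ ℚ.< η → ∃[ n ] d ℚ.≤ fromℕ n ℚ.* η
archimedean {η} d 0<η = let n = ℤ.∣ ℚ.↥ (d ℚ.* 1/η) ∣ in
  n , subst (ℚ._≤ fromℕ n ℚ.* η)
        (trans (ℚₚ.*-assoc d 1/η η) (trans (cong (d ℚ.*_) (ℚₚ.*-inverseˡ η)) (ℚₚ.*-identityʳ d)))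
        (ℚₚ.*-monoʳ-≤-nonNeg η (≤-fromℕ (d ℚ.* 1/η)))
  where
  instance
    η-pos = ℚ.positive 0<η
    η-nonZero = ℚₚ.pos⇒nonZero η
    η-nonNeg = ℚₚ.pos⇒nonNeg η
  1/η = ℚ.1/ η

below-outside : ∀ x {p q} → p ∈ lower x → q ∉ lower x → p ℚ.< q
below-outside x p∈ q∉ = ℚₚ.≰⇒> (λ q≤p → q∉ (downClosed x q≤p p∈))

∉-up : ∀ x {p q} → p ℚ.≤ q → p ∉ lower x → q ∉ lower x
∉-up x p≤q p∉ q∈ = p∉ (downClosed x p≤q q∈)

-- The cut of `- y` consists of the points strictly below some `- u`; the `c` between `p + u` and
-- `a` leaves room for such a point and for the strict sum.
∈-sub⁺ : ∀ x y {p a u} → a ∈ lower x → u ∉ lower y → p ℚ.+ u ℚ.< a → p ∈ lower (x - y)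
∈-sub⁺ x y {p} {a} {u} a∈ u∉ p+u<a =
  let c , p+u<c , c<a = ℚₚ.<-dense p+u<a
  in a , c ℚ.- u ℚ.- a ℚ.+ 0ℚ , a∈
   , (u , u∉ , <-diff c<a (solve 3 (λ a u c → (:- u) :- (c :- u :- a :+ con 0ℚ) := a :- c) refl a u c))
   , <-diff p+u<c (solve 4 (λ p a u c → a :+ (c :- u :- a :+ con 0ℚ) :- p := c :- (p :+ u)) refl p a u c)

∈-sub⁻ : ∀ x y {p} → p ∈ lower (x - y) → ∃[ a ] ∃[ u ] (a ∈ lower x × u ∉ lower y × p ℚ.+ u ℚ.< a)
∈-sub⁻ x y {p} (a , b , a∈ , (u , u∉ , b<-u) , p<a+b) =
  a , u , a∈ , u∉
  , <-diff (p<a+b +< b<-u) (solve 4 (λ p a u b → a :- (p :+ u) := a :+ b :+ (:- u) :- (p :+ b)) refl p a u b)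

-- Upper bounds `u` of `x` and lower bounds `b` of `y` are all that an estimate of 1 - x + y uses,
-- so the sums of cuts inside the implication need no further unfolding.
⇛⁺ : ∀ x y {p u b} → p ℚ.< 1ℚ → u ∉ lower (val x) → b ∈ lower (val y) →
     p ℚ.+ u ℚ.< 1ℚ ℚ.+ b → p ∈ lower (val (x ⇛ y))
⇛⁺ x y {p} {u} {b} p<1 u∉ b∈ lt =
  let c , lt₁ , lt₂ = ℚₚ.<-dense lt
      d , lt₃ , lt₄ = ℚₚ.<-dense lt₂
  in ( c ℚ.- b ℚ.- u , b
     , ∈-sub⁺ 1ℝ (val x) {a = 1ℚ ℚ.+ (d ℚ.- (1ℚ ℚ.+ b))}
         (<-diff lt₄ (solve 2 (λ b d → con 1ℚ :- (con 1ℚ :+ (d :- (con 1ℚ :+ b))) := con 1ℚ :+ b :- d) refl b d))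
         u∉
         (<-diff lt₃ (solve 4 (λ b c d u → con 1ℚ :+ (d :- (con 1ℚ :+ b)) :- (c :- b :- u :+ u) := d :- c) refl b c d u))
     , b∈
     , <-diff lt₁ (solve 4 (λ b c p u → c :- b :- u :+ b :- p := c :- (p :+ u)) refl b c p u))
   , p<1

⇛⁻ : ∀ x y {p} → p ∈ lower (val (x ⇛ y)) →
     p ℚ.< 1ℚ × ∃[ u ] ∃[ b ] (u ∉ lower (val x) × b ∈ lower (val y) × p ℚ.+ u ℚ.< 1ℚ ℚ.+ b)
⇛⁻ x y {p} ((a , b , a∈ , b∈ , p<a+b) , p<1) =
  let c , u , c<1 , u∉ , a+u<c = ∈-sub⁻ 1ℝ (val x) a∈
  in p<1 , u , b , u∉ , b∈
   , <-diff (p<a+b +< a+u<c +< c<1)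
       (solve 5 (λ p a b c u → con 1ℚ :+ b :- (p :+ u) := a :+ b :+ c :+ con 1ℚ :- (p :+ (a :+ u) :+ c)) refl p a b c u)

⇛-mono : ∀ {x x′ y y′} → val x′ ≤ val x → val y ≤ val y′ → val (x ⇛ y) ≤ val (x′ ⇛ y′)
⇛-mono {x} {x′} {y} {y′} x′≤x y≤y′ p∈ =
  let p<1 , u , b , u∉ , b∈ , lt = ⇛⁻ x y p∈
  in ⇛⁺ x′ y′ p<1 (λ u∈ → u∉ (x′≤x u∈)) (y≤y′ b∈) lt

⇛-cong : ∀ {x x′ y y′} → val x ≈ val x′ → val y ≈ val y′ → val (x ⇛ y) ≈ val (x′ ⇛ y′)
⇛-cong {x} {x′} {y} {y′} (x≤ , x≥) (y≤ , y≥) =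
  ⇛-mono {x} {x′} {y} {y′} x≥ y≤ , ⇛-mono {x′} {x} {y′} {y} x≤ y≥

⋁-mono : ∀ {I} {f g : I → 𝕀} → (∀ i → val (f i) ≤ val (g i)) → val (⋁ f) ≤ val (⋁ g)
⋁-mono f≤g (inj₁ p<0)      = inj₁ p<0
⋁-mono f≤g (inj₂ (i , p∈)) = inj₂ (i , f≤g i p∈)

⋁-cong : ∀ {I} {f g : I → 𝕀} → (∀ i → val (f i) ≈ val (g i)) → val (⋁ f) ≈ val (⋁ g)
⋁-cong {f = f} {g} f≈g =
  ⋁-mono {f = f} {g} (λ i → proj₁ (f≈g i)) , ⋁-mono {f = g} {f} (λ i → proj₂ (f≈g i))

-- Negation and positive values

0F 1F : ℚ[0,1]
0F = mk 0ℚ ℚₚ.≤-refl (ℚₚ.nonNegative⁻¹ 1ℚ)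
1F = mk 1ℚ (ℚₚ.nonNegative⁻¹ 1ℚ) ℚₚ.≤-refl

0<1 : 0ℚ ℚ.< 1ℚ
0<1 = ℚₚ.positive⁻¹ 1ℚ

-- `eval` of `¬F φ` is definitionally `∁` of `eval` of `φ`, so facts about `∁` apply to negated
-- formulas without conversion.
∁ : 𝕀 → 𝕀
∁ x = x ⇛ fromℚ[0,1] 0F

Pos : 𝕀 → Set
Pos x = 0ℚ ∈ lower (val x)

<-absurd : ∀ {r s} → r ℚ.< s → 0ℚ ≡ s ℚ.- r → ⊥
<-absurd r<s eq = ℚₚ.<-irrefl eq (<⇒0<- r<s)

nonneg-∉ : ∀ (x : 𝕀) {q} → q ∉ lower (val x) → 0ℚ ℚ.≤ q
nonneg-∉ x q∉ = ℚₚ.≮⇒≥ (λ q<0 → q∉ (0≤val x q<0))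

∁⁺ : ∀ x {p u} → p ℚ.< 1ℚ → u ∉ lower (val x) → p ℚ.+ u ℚ.< 1ℚ → p ∈ lower (val (∁ x))
∁⁺ x {p} {u} p<1 u∉ lt =
  let c , lt₁ , lt₂ = ℚₚ.<-dense lt
  in ⇛⁺ x (fromℚ[0,1] 0F) {b = c ℚ.- 1ℚ} p<1 u∉
       (<-diff lt₂ (solve 1 (λ c → con 0ℚ :- (c :- con 1ℚ) := con 1ℚ :- c) refl c))
       (<-diff lt₁ (solve 3 (λ c p u → con 1ℚ :+ (c :- con 1ℚ) :- (p :+ u) := c :- (p :+ u)) refl c p u))

∁⁻ : ∀ x {p} → p ∈ lower (val (∁ x)) → ∃[ u ] (u ∉ lower (val x) × p ℚ.+ u ℚ.< 1ℚ)
∁⁻ x {p} p∈ =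
  let _ , u , b , u∉ , b<0 , lt = ⇛⁻ x (fromℚ[0,1] 0F) p∈
  in u , u∉ , <-diff (lt +< b<0)
       (solve 3 (λ b p u → con 1ℚ :- (p :+ u) := con 1ℚ :+ b :+ con 0ℚ :- (p :+ u :+ b)) refl b p u)

-- Consequences of excluded middle for cuts

module Classical (em : ExcludedMiddle (lsuc 0ℓ)) where

  em₀ : {P : Set} → Dec P
  em₀ {P} with em {Lift (lsuc 0ℓ) P}
  ... | yes (lift p) = yes p
  ... | no ¬p        = no (λ p → ¬p (lift p))

  stable : {P : Set} → ¬ ¬ P → P
  stable = decidable-stable em₀

  -- Steps of length `η` that start inside the cut leave it after finitely many, by the Archimedean
  -- property; excluded middle finds the last point inside.
  approx : ∀ x {η} → 0ℚ ℚ.< η → ∃[ p ] (p ∈ lower x × p ℚ.+ η ∉ lower x)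
  approx x {η} 0<η =
    let a , a∈ = inhabited x
        u , u∉ = bounded x
        n , u-a≤nη = archimedean (u ℚ.- a) 0<η
    in search n a∈ (∉-up x (subst (ℚ._≤ a ℚ.+ fromℕ n ℚ.* η)
                       (solve 2 (λ a u → a :+ (u :- a) := u) refl a u)
                       (ℚₚ.+-monoʳ-≤ a u-a≤nη)) u∉)
    where
    search : ∀ n {a} → a ∈ lower x → a ℚ.+ fromℕ n ℚ.* η ∉ lower x →
             ∃[ p ] (p ∈ lower x × p ℚ.+ η ∉ lower x)
    search zero {a} a∈ a∉ = ⊥-elim (a∉ (subst (_∈ lower x)
      (solve 2 (λ a η → a := a :+ con 0ℚ :* η) refl a η) a∈))
    search (suc n) {a} a∈ out with em₀ {a ℚ.+ η ∈ lower x}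
    ... | no a+η∉  = a , a∈ , a+η∉
    ... | yes a+η∈ = search n a+η∈ (subst (_∉ lower x)
      (solve 3 (λ a η m → a :+ (con 1ℚ :+ m) :* η := a :+ η :+ m :* η) refl a η (fromℕ n)) out)

  -- The value of `∁ (x ⇛ y)` is the truncated difference max(x - y, 0).
  Pos-∁⇛⁺ : ∀ x y → val y < val x → Pos (∁ (x ⇛ y))
  Pos-∁⇛⁺ x y (p , p∉y , p∈x) =
    let p′ , p<p′ , p′∈x = open′ (val x) p∈x
        u , 1+p<u , u<1+p′ = ℚₚ.<-dense (ℚₚ.+-monoʳ-< 1ℚ p<p′)
    -- As 1 + p < u < 1 + p′, the number `u - p′` is below 1 and still bounds 1 - x + y from above.
    in ∁⁺ (x ⇛ y) {u = u ℚ.- p′} 0<1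
         (λ v∈ → let _ , w , b , w∉ , b∈ , lt = ⇛⁻ x y v∈ in
           <-absurd
             (lt +< below-outside (val x) p′∈x w∉ +< below-outside (val y) b∈ p∉y +< 1+p<u)
             (solve 5 (λ u p′ w b p → con 0ℚ :=
                con 1ℚ :+ b :+ w :+ p :+ u :- (u :- p′ :+ w :+ p′ :+ b :+ (con 1ℚ :+ p))) refl u p′ w b p))
         (<-diff u<1+p′ (solve 2 (λ u p′ → con 1ℚ :- (con 0ℚ :+ (u :- p′)) := con 1ℚ :+ p′ :- u) refl u p′))

  Pos-∁⇛⁻ : ∀ x y → Pos (∁ (x ⇛ y)) → val y < val x
  Pos-∁⇛⁻ x y pos =
    let u , u∉ , 0+u<1 = ∁⁻ (x ⇛ y) pos
        u<1 = <-diff 0+u<1 (solve 1 (λ u → con 1ℚ :- u := con 1ℚ :- (con 0ℚ :+ u)) refl u)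
        -- `x ⇛ y` is at most `u`, so `x` exceeds `y` by at least 1 - u; approximating `x` to within
        -- this gap yields a point that `y` cannot exceed.
        p , p∈x , p+η∉x = approx (val x) (<⇒0<- u<1)
    in p , (λ p∈y → let b , p<b , b∈y = open′ (val y) p∈y in
             u∉ (⇛⁺ x y u<1 p+η∉x b∈y
               (<-diff p<b (solve 3 (λ p b u → con 1ℚ :+ b :- (u :+ (p :+ (con 1ℚ :- u))) := b :- p) refl p b u))))
         , p∈x

  -- The value is min(x, y).
  _∧_ : 𝕀 → 𝕀 → 𝕀
  x ∧ y = ∁ ((∁ x ⇛ ∁ y) ⇛ ∁ y)

  -- With `∁ x ⇛ ∁ y` equal to min(1, 1 + x - y), the claim becomes 1 - y < min(1, 1 + x - y).
  Pos-∧⁺ : ∀ x y → Pos x → Pos y → Pos (x ∧ y)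
  Pos-∧⁺ x y 0∈x 0∈y =
    let a , 0<a , a∈x = open′ (val x) 0∈x
        c , 0<c , c∈y = open′ (val y) 0∈y
        h , 0<h , h<a = ℚₚ.<-dense 0<a
        b , b∈ , b+h∉ = approx (val (∁ y)) 0<h
        1-c∉ : 1ℚ ℚ.- c ∉ lower (val (∁ y))
        1-c∉ m = let u , u∉ , lt = ∁⁻ y m in <-absurd (lt +< below-outside (val y) c∈y u∉)
                   (solve 2 (λ c u → con 0ℚ := con 1ℚ :+ u :- (con 1ℚ :- c :+ u :+ c)) refl c u)
        1-a∉ : 1ℚ ℚ.- a ∉ lower (val (∁ x))
        1-a∉ m = let u , u∉ , lt = ∁⁻ x m in <-absurd (lt +< below-outside (val x) a∈x u∉)
                   (solve 2 (λ c u → con 0ℚ := con 1ℚ :+ u :- (con 1ℚ :- c :+ u :+ c)) refl a u)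
        -- Both `b + h` and `1 - c` bound `∁ y` from above; the first is below 1 + x - y because h <
        -- a, the second is below 1.
        m = (b ℚ.+ h) ℚ.⊓ (1ℚ ℚ.- c)
    in Pos-∁⇛⁺ (∁ x ⇛ ∁ y) (∁ y)
         ( m
         , [⊓]-∉ (b ℚ.+ h) (1ℚ ℚ.- c) b+h∉ 1-c∉
         , ⇛⁺ (∁ x) (∁ y)
             (ℚₚ.≤-<-trans (ℚₚ.p⊓q≤q (b ℚ.+ h) (1ℚ ℚ.- c))
               (<-diff 0<c (solve 1 (λ c → con 1ℚ :- (con 1ℚ :- c) := c :- con 0ℚ) refl c)))
             1-a∉ b∈
             (ℚₚ.≤-<-trans (ℚₚ.+-monoˡ-≤ (1ℚ ℚ.- a) (ℚₚ.p⊓q≤p (b ℚ.+ h) (1ℚ ℚ.- c)))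
               (<-diff h<a (solve 3 (λ a b h → con 1ℚ :+ b :- (b :+ h :+ (con 1ℚ :- a)) := a :- h) refl a b h))))
    where
    [⊓]-∉ : ∀ p q → p ∉ lower (val (∁ y)) → q ∉ lower (val (∁ y)) → p ℚ.⊓ q ∉ lower (val (∁ y))
    [⊓]-∉ p q p∉ q∉ with ℚₚ.⊓-sel p q
    ... | inj₁ eq = subst (_∉ lower (val (∁ y))) (sym eq) p∉
    ... | inj₂ eq = subst (_∉ lower (val (∁ y))) (sym eq) q∉

  Pos-∧⁻ : ∀ x y → Pos (x ∧ y) → Pos x × Pos y
  Pos-∧⁻ x y pos =
    let p , p∉ , p∈ = Pos-∁⇛⁻ (∁ x ⇛ ∁ y) (∁ y) pos
        p<1 , u , b , u∉ , b∈ , lt = ⇛⁻ (∁ x) (∁ y) p∈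
        u<1 = <-diff (lt +< below-outside (val (∁ y)) b∈ p∉)
                (solve 3 (λ p u b → con 1ℚ :- u := con 1ℚ :+ b :+ p :- (p :+ u :+ b)) refl p u b)
    in stable (λ 0∉ → u∉ (∁⁺ x {u = 0ℚ} u<1 0∉ (subst (ℚ._< 1ℚ) (sym (ℚₚ.+-identityʳ u)) u<1)))
     , stable (λ 0∉ → p∉ (∁⁺ y {u = 0ℚ} p<1 0∉ (subst (ℚ._< 1ℚ) (sym (ℚₚ.+-identityʳ p)) p<1)))

  -- The gap between `p` and `- u` is split at `m` into the errors allowed in approximating `y` and
  -- `x`; finding these approximations is the classical part.
  neg-sub≤ : ∀ x y → - (x - y) ≤ y - x
  neg-sub≤ x y {p} (u , u∉ , p<-u) =
    let m , p<m , m<-u = ℚₚ.<-dense p<-u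
        β , β∈ , β+η∉ = approx y (<⇒0<- p<m)
        α , α∈ , α+η∉ = approx x (<⇒0<- m<-u)
        α′ , α<α′ , α′∈ = open′ x α∈
        α′≤ : α′ ℚ.≤ u ℚ.+ (β ℚ.+ (m ℚ.- p))
        α′≤ = ℚₚ.≮⇒≥ (λ lt → u∉ (∈-sub⁺ x y α′∈ β+η∉ lt))
    in ∈-sub⁺ y x β∈ α+η∉ (<-diff (ℚₚ.<-≤-trans α<α′ α′≤)
         (solve 5 (λ p u m α β → β :- (p :+ (α :+ ((:- u) :- m))) := u :+ (β :+ (m :- p)) :- α) refl p u m α β))

  sub≤neg-sub : ∀ x y → y - x ≤ - (x - y)
  sub≤neg-sub x y {p} p∈ =
    let a , u , a∈y , u∉x , p+u<a = ∈-sub⁻ y x p∈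
    in u ℚ.- a
     , (λ m → let c , w , c∈x , w∉y , lt = ∈-sub⁻ x y m in
          <-absurd (lt +< below-outside x c∈x u∉x +< below-outside y a∈y w∉y)
            (solve 4 (λ a u c w → con 0ℚ := c :+ u :+ w :- (u :- a :+ w :+ c :+ a)) refl a u c w))
     , <-diff p+u<a (solve 3 (λ p a u → :- (u :- a) :- p := a :- (p :+ u)) refl p a u)

-- Semantics of substitution

≈-refl : ∀ x → x ≈ x
≈-refl x = (λ p∈ → p∈) , (λ p∈ → p∈)

≈-reflexive : ∀ {x y : 𝕀} → x ≡ y → val x ≈ val y
≈-reflexive {x} refl = ≈-refl (val x)

-- Assignments and their prefixes

prefix : ∀ {A : Set} n → (ℕ → A) → Vec A n
prefix n b = tabulate (b ∘ toℕ)

-- All entries from `k` on become `a`, which is harmless: contexts of size at most `k` do not see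
-- them, and only entry `k` is read off later.
override : ∀ {A : Set} → (ℕ → A) → ℕ → A → ℕ → A
override b k a i = Bool.if i ℕ.<ᵇ k then b i else a

override-< : ∀ {A : Set} (b : ℕ → A) k a {i} → i ℕ.< k → override b k a i ≡ b i
override-< b k a {i} i<k with i ℕ.<ᵇ k | ℕₚ.<⇒<ᵇ i<k
... | Bool.true | _ = refl

override-≡ : ∀ {A : Set} (b : ℕ → A) k a → override b k a k ≡ a
override-≡ b k a with k ℕ.<ᵇ k in eq
... | Bool.false = refl
... | Bool.true  = ⊥-elim (ℕₚ.<-irrefl {k} refl (ℕₚ.<ᵇ⇒< k k (subst Bool.T (sym eq) _)))

prefix-override : ∀ {A : Set} (b : ℕ → A) k a {n} → n ℕ.≤ k → prefix n (override b k a) ≡ prefix n b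
prefix-override b k a n≤k = tabulate-cong (λ i → override-< b k a (ℕₚ.<-≤-trans (toℕ<n i) n≤k))

-- Turns a tuple as it occurs in `Principal` into the beginning of an assignment, `a` filling the
-- remaining entries.
prefix-extension : ∀ {A : Set} {k} (a : A) (as : Vec A k) → ∃[ b ] prefix k b ≡ as
prefix-extension a []       = (λ _ → a) , refl
prefix-extension a (x ∷ as) =
  let b , eq = prefix-extension a as in
  (λ { zero → x ; (suc i) → b i }) , cong (x ∷_) eq

-- Identity of formulas and the substitution lemma

module _ {S : Signature} where

  ≅-sym : ∀ {n} {φ ψ : Formula S n} → φ ≅ ψ → ψ ≅ φ
  ≅-sym distF    = distF
  ≅-sym predF    = predF
  ≅-sym const    = const
  ≅-sym (p ⇒ q)  = ≅-sym p ⇒ ≅-sym q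
  ≅-sym (supX p) = supX (≅-sym p)
  ≅-sym (supN p) = supN (λ k → ≅-sym (p k))

  ≅-refl : ∀ {n} {φ : Formula S n} → φ ≅ φ
  ≅-refl {φ = distF s t}  = distF
  ≅-refl {φ = predF P ts} = predF
  ≅-refl {φ = const q}    = const
  ≅-refl {φ = φ ⇒ ψ}      = ≅-refl ⇒ ≅-refl
  ≅-refl {φ = supX φ}     = supX ≅-refl
  ≅-refl {φ = supN φs}    = supN (λ k → ≅-refl)

  ≅-trans : ∀ {n} {φ ψ χ : Formula S n} → φ ≅ ψ → ψ ≅ χ → φ ≅ χ
  ≅-trans distF    distF      = distF
  ≅-trans predF    predF      = predF
  ≅-trans const    const      = const
  ≅-trans (p ⇒ q)  (p′ ⇒ q′)  = ≅-trans p p′ ⇒ ≅-trans q q′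
  ≅-trans (supX p) (supX p′)  = supX (≅-trans p p′)
  ≅-trans (supN p) (supN p′)  = supN (λ k → ≅-trans (p k) (p′ k))

  -- All contexts are initial segments of one list of variables, so weakening keeps every index.
  wk : ∀ {m n} → m ℕ.≤ n → Sub (Term S) m n
  wk m≤n = tabulate (λ i → var (inject≤ i m≤n))

  module _ (𝓜 : Structure S) where
    open Structure 𝓜

    eval-≅ : ∀ {n} {φ ψ : Formula S n} → φ ≅ ψ → ∀ as → val (eval 𝓜 φ as) ≈ val (eval 𝓜 ψ as)
    eval-≅ {φ = φ} distF as = ≈-refl (val (eval 𝓜 φ as))
    eval-≅ {φ = φ} predF as = ≈-refl (val (eval 𝓜 φ as))
    eval-≅ {φ = φ} const as = ≈-refl (val (eval 𝓜 φ as))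
    eval-≅ (_⇒_ {φ} {φ′} {ψ} {ψ′} p q) as =
      ⇛-cong {eval 𝓜 φ as} {eval 𝓜 φ′ as} {eval 𝓜 ψ as} {eval 𝓜 ψ′ as} (eval-≅ p as) (eval-≅ q as)
    eval-≅ (supX {φ} {φ′} p) as =
      ⋁-cong {f = λ a → eval 𝓜 φ (a ∷ as)} {λ a → eval 𝓜 φ′ (a ∷ as)} (λ a → eval-≅ p (a ∷ as))
    eval-≅ (supN {φs} {φs′} p) as =
      ⋁-cong {f = λ k → eval 𝓜 (φs k) as} {λ k → eval 𝓜 (φs′ k) as} (λ k → eval-≅ (p k) as)

    mutual
      evalTerm-weaken : ∀ {n} a (as : Vec Carrier n) t →
                        evalTerm 𝓜 (a ∷ as) (renameTerm suc t) ≡ evalTerm 𝓜 as t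
      evalTerm-weaken a as (var i)    = refl
      evalTerm-weaken a as (con c)    = refl
      evalTerm-weaken a as (app f ts) = cong (funI f) (evalTerms-weaken a as ts)

      evalTerms-weaken : ∀ {n k} a (as : Vec Carrier n) (ts : Vec (Term S n) k) →
                         evalTerms 𝓜 (a ∷ as) (renameTerms suc ts) ≡ evalTerms 𝓜 as ts
      evalTerms-weaken a as []       = refl
      evalTerms-weaken a as (t ∷ ts) = cong₂ _∷_ (evalTerm-weaken a as t) (evalTerms-weaken a as ts)

    evalTerms-map-weaken : ∀ {n k} a (as : Vec Carrier n) (σ : Sub (Term S) k n) →
                           evalTerms 𝓜 (a ∷ as) (map (renameTerm suc) σ) ≡ evalTerms 𝓜 as σ
    evalTerms-map-weaken a as []      = refl
    evalTerms-map-weaken a as (t ∷ σ) = cong₂ _∷_ (evalTerm-weaken a as t) (evalTerms-map-weaken a as σ)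

    lookup-evalTerms : ∀ {n k} (as : Vec Carrier n) (σ : Sub (Term S) k n) i →
                       evalTerm 𝓜 as (lookup σ i) ≡ lookup (evalTerms 𝓜 as σ) i
    lookup-evalTerms as (t ∷ σ) zero    = refl
    lookup-evalTerms as (t ∷ σ) (suc i) = lookup-evalTerms as σ i

    mutual
      evalTerm-subst : ∀ {m n} (σ : Sub (Term S) m n) as t →
                       evalTerm 𝓜 as (substTerm σ t) ≡ evalTerm 𝓜 (evalTerms 𝓜 as σ) t
      evalTerm-subst σ as (var i)    = lookup-evalTerms as σ i
      evalTerm-subst σ as (con c)    = refl
      evalTerm-subst σ as (app f ts) = cong (funI f) (evalTerms-subst σ as ts)

      evalTerms-subst : ∀ {m n k} (σ : Sub (Term S) m n) as (ts : Vec (Term S m) k) →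
                        evalTerms 𝓜 as (substTerms σ ts) ≡ evalTerms 𝓜 (evalTerms 𝓜 as σ) ts
      evalTerms-subst σ as []       = refl
      evalTerms-subst σ as (t ∷ ts) = cong₂ _∷_ (evalTerm-subst σ as t) (evalTerms-subst σ as ts)

    eval-subst : ∀ {m n} (σ : Sub (Term S) m n) φ as →
                 val (eval 𝓜 (substFormula σ φ) as) ≈ val (eval 𝓜 φ (evalTerms 𝓜 as σ))
    eval-subst σ (distF s t) as =
      ≈-reflexive (cong₂ dist (evalTerm-subst σ as s) (evalTerm-subst σ as t))
    eval-subst σ (predF P ts) as = ≈-reflexive (cong (predI P) (evalTerms-subst σ as ts))
    eval-subst σ (const q) as = ≈-refl (fromℚ (ℚ[0,1].rat q))
    eval-subst σ (φ ⇒ ψ) as =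
      ⇛-cong {eval 𝓜 (substFormula σ φ) as} {eval 𝓜 φ (evalTerms 𝓜 as σ)}
             {eval 𝓜 (substFormula σ ψ) as} {eval 𝓜 ψ (evalTerms 𝓜 as σ)}
             (eval-subst σ φ as) (eval-subst σ ψ as)
    eval-subst σ (supX φ) as =
      -- The substitution written out here is what `σ ↑` unfolds to.
      ⋁-cong {f = λ a → eval 𝓜 (substFormula (var zero ∷ map (renameTerm suc) σ) φ) (a ∷ as)}
             {λ a → eval 𝓜 φ (a ∷ evalTerms 𝓜 as σ)} (λ a →
        subst (λ bs → val (eval 𝓜 (substFormula (var zero ∷ map (renameTerm suc) σ) φ) (a ∷ as)) ≈
                      val (eval 𝓜 φ (a ∷ bs)))
          (evalTerms-map-weaken a as σ)
          (eval-subst (var zero ∷ map (renameTerm suc) σ) φ (a ∷ as)))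
    eval-subst σ (supN φs) as =
      ⋁-cong {f = λ k → eval 𝓜 (substFormula σ (φs k)) as} {λ k → eval 𝓜 (φs k) (evalTerms 𝓜 as σ)}
             (λ k → eval-subst σ (φs k) as)

    evalTerms-tabulate : ∀ {n k} as (f : Fin k → Term S n) →
                         evalTerms 𝓜 as (tabulate f) ≡ tabulate (evalTerm 𝓜 as ∘ f)
    evalTerms-tabulate {k = zero}  as f = refl
    evalTerms-tabulate {k = suc k} as f = cong (evalTerm 𝓜 as (f zero) ∷_) (evalTerms-tabulate as (f ∘ suc))

  evalTerms-wk : ∀ 𝓜 {m n} (m≤n : m ℕ.≤ n) b → evalTerms 𝓜 (prefix n b) (wk m≤n) ≡ prefix m b
  evalTerms-wk 𝓜 {m} {n} m≤n b = trans (evalTerms-tabulate 𝓜 (prefix n b) (λ i → var (inject≤ i m≤n)))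
    (tabulate-cong (λ i → trans (lookup∘tabulate (b ∘ toℕ) (inject≤ i m≤n)) (cong b (toℕ-inject≤ i m≤n))))

-- Forcing

module Forcing (em : ExcludedMiddle (lsuc 0ℓ)) {S : Signature} (L : Fragment S)
               (T : Pred (Formula S 0) 0ℓ) where
  open Classical em
  open Fragment L
  open Structure using (Carrier; nonempty)

  -- An assignment covers all variables at once, so that formulas in different contexts can be
  -- combined; one in `n` variables reads the first `n` entries.
  record World : Set₁ where
    field
      str     : Structure S
      isModel : IsModel str T
      env     : ℕ → Carrier str

  open World

  ev : ∀ {n} → Formula S n → World → 𝕀
  ev {n} φ w = eval (str w) φ (prefix n (env w))

  Elem : Set
  Elem = Σ[ n ∈ ℕ ] Term S n

  ⟦_⟧ : Elem → (w : World) → Carrier (str w)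
  ⟦ n , t ⟧ w = evalTerm (str w) (prefix n (env w)) t

  evT : ∀ {n k} → Vec (Term S n) k → (w : World) → Vec (Carrier (str w)) k
  evT {n} ts w = evalTerms (str w) (prefix n (env w)) ts

  ev-wk : ∀ {m n} (m≤n : m ℕ.≤ n) φ w → val (ev (substFormula (wk m≤n) φ) w) ≈ val (ev φ w)
  ev-wk {m} {n} m≤n φ w =
    subst (λ as → val (ev (substFormula (wk m≤n) φ) w) ≈ val (eval (str w) φ as))
      (evalTerms-wk (str w) m≤n (env w))
      (eval-subst (str w) (wk m≤n) φ (prefix n (env w)))

  -- The values are min(φ, ψ) and max(φ − ψ, 0).
  infixl 6 _∧F_ _∸F_

  _∧F_ _∸F_ : ∀ {n} → Formula S n → Formula S n → Formula S n
  φ ∧F ψ = ¬F ((¬F φ ⇒ ¬F ψ) ⇒ ¬F ψ)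
  φ ∸F ψ = ¬F (φ ⇒ ψ)

  ∧-closed : ∀ {n} {φ ψ : Formula S n} → φ ∈ formulas n → ψ ∈ formulas n → (φ ∧F ψ) ∈ formulas n
  ∧-closed φ∈ ψ∈ = ¬-closed (⇒-closed (⇒-closed (¬-closed φ∈) (¬-closed ψ∈)) (¬-closed ψ∈))

  -- Conditions and what they decide

  record Condition : Set₁ where
    field
      {ctx}   : ℕ
      formula : Formula S ctx
      inL     : formula ∈ formulas ctx
      world   : World
      holds   : Pos (ev formula world)

  open Condition

  infix 4 _⊩_ _≼_

  Meets : Condition → World → Set
  Meets c w = Pos (ev (formula c) w)

  _⊩_ : Condition → (World → Set) → Set₁
  c ⊩ P = ∀ w → Meets c w → P w

  _≼_ : Condition → Condition → Set₁
  c′ ≼ c = c′ ⊩ Meets c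

  -- The conjunction of the two formulas, moved into a context that holds both; the world `w` shows
  -- that it is consistent with `T`.
  extend : ∀ c {n} {χ : Formula S n} → χ ∈ formulas n → ∀ w → Meets c w → Pos (ev χ w) →
           Σ[ c′ ∈ Condition ] (c′ ≼ c × c′ ⊩ λ w → Pos (ev χ w))
  extend c {n} {χ} χ∈ w γ>0 χ>0 = record
      { formula = γ′ ∧F χ′
      ; inL     = ∧-closed (subst-closed (wk m≤) (inL c)) (subst-closed (wk n≤) χ∈)
      ; world   = w
      ; holds   = Pos-∧⁺ (ev γ′ w) (ev χ′ w) (proj₂ (ev-wk m≤ (formula c) w) γ>0)
                                             (proj₂ (ev-wk n≤ χ w) χ>0)
      }
    , (λ v pos → proj₁ (ev-wk m≤ (formula c) v) (proj₁ (Pos-∧⁻ (ev γ′ v) (ev χ′ v) pos)))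
    , (λ v pos → proj₁ (ev-wk n≤ χ v) (proj₂ (Pos-∧⁻ (ev γ′ v) (ev χ′ v) pos)))
    where
    m≤ = ℕₚ.m≤m+n (ctx c) n
    n≤ = ℕₚ.m≤n+m n (ctx c)
    γ′ = substFormula (wk m≤) (formula c)
    χ′ = substFormula (wk n≤) χ

  -- Conjoins `φ ∸F const q`, which is positive exactly where `φ` exceeds `q`.
  force-∈ : ∀ c {n} {φ : Formula S n} → φ ∈ formulas n → ∀ (q : ℚ[0,1]) w → Meets c w →
            ℚ[0,1].rat q ∈ lower (val (ev φ w)) →
            Σ[ c′ ∈ Condition ] (c′ ≼ c × c′ ⊩ λ w → ℚ[0,1].rat q ∈ lower (val (ev φ w)))
  force-∈ c {n} {φ} φ∈ q w γ>0 q∈ =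
    let c′ , c′≼c , c′⊩ = extend c {χ = φ ∸F const q} (¬-closed (⇒-closed φ∈ (has-const q))) w γ>0
                            (Pos-∁⇛⁺ (ev φ w) (fromℚ[0,1] q) (ℚ[0,1].rat q , ℚₚ.<-irrefl refl , q∈))
    in c′ , c′≼c , λ v m → let p , p≮q , p∈ = Pos-∁⇛⁻ (ev φ v) (fromℚ[0,1] q) (c′⊩ v m) in
         downClosed (val (ev φ v)) (ℚₚ.≮⇒≥ p≮q) p∈

  force-∉ : ∀ c {n} {φ : Formula S n} → φ ∈ formulas n → ∀ (q : ℚ[0,1]) w → Meets c w →
            val (ev φ w) < fromℚ (ℚ[0,1].rat q) →
            Σ[ c′ ∈ Condition ] (c′ ≼ c × c′ ⊩ λ w → ℚ[0,1].rat q ∉ lower (val (ev φ w)))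
  force-∉ c {n} {φ} φ∈ q w γ>0 lt =
    let c′ , c′≼c , c′⊩ = extend c {χ = const q ∸F φ} (¬-closed (⇒-closed (has-const q) φ∈)) w γ>0
                            (Pos-∁⇛⁺ (fromℚ[0,1] q) (ev φ w) lt)
    in c′ , c′≼c , λ v m → let p , p∉ , p<q = Pos-∁⇛⁻ (fromℚ[0,1] q) (ev φ v) (c′⊩ v m) in
         ∉-up (val (ev φ v)) (ℚₚ.<⇒≤ p<q) p∉

  -- The Henkin property is built in: for a supremum, a single element or index witnesses the bound
  -- in all worlds meeting `c`.
  Forced : ∀ {n} → Condition → Formula S n → ℚ → Set₁
  Forced c φ@(distF _ _) q = c ⊩ λ w → q ∈ lower (val (ev φ w))
  Forced c φ@(predF _ _) q = c ⊩ λ w → q ∈ lower (val (ev φ w))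
  Forced c φ@(const _)   q = c ⊩ λ w → q ∈ lower (val (ev φ w))
  Forced c φ@(_ ⇒ _)     q = c ⊩ λ w → q ∈ lower (val (ev φ w))
  Forced {n} c (supX φ)  q = Σ[ x ∈ Elem ] (c ⊩ λ w →
                               q ∈ lower (val (eval (str w) φ (⟦ x ⟧ w ∷ prefix n (env w)))))
  Forced c (supN φs)     q = Σ[ k ∈ ℕ ] (c ⊩ λ w → q ∈ lower (val (ev (φs k) w)))

  Forced⇒∈ : ∀ {n} c (φ : Formula S n) {q} → Forced c φ q → c ⊩ λ w → q ∈ lower (val (ev φ w))
  Forced⇒∈ c (distF _ _) f = f
  Forced⇒∈ c (predF _ _) f = f
  Forced⇒∈ c (const _)   f = f
  Forced⇒∈ c (_ ⇒ _)     f = f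
  Forced⇒∈ c (supX φ) (x , f) w m = inj₂ (⟦ x ⟧ w , f w m)
  Forced⇒∈ c (supN φs) (k , f) w m = inj₂ (k , f w m)

  Forced-≅ : ∀ {n c q} {φ ψ : Formula S n} → φ ≅ ψ → Forced c φ q → Forced c ψ q
  Forced-≅ distF f = f
  Forced-≅ predF f = f
  Forced-≅ const f = f
  Forced-≅ {n} e@(_ ⇒ _) f w m = proj₁ (eval-≅ (str w) e (prefix n (env w))) (f w m)
  Forced-≅ (supX e) (x , f) = x , λ w m → proj₁ (eval-≅ (str w) e _) (f w m)
  Forced-≅ (supN e) (k , f) = k , λ w m → proj₁ (eval-≅ (str w) (e k) _) (f w m)

  -- A bound `q` strictly above `p` is demanded so that the cuts of the generic model are open.
  Decided : ∀ {n} → Condition → Formula S n → ℚ → Set₁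
  Decided c φ p = (c ⊩ λ w → p ∉ lower (val (ev φ w))) ⊎ (∃[ q ] (p ℚ.< q × Forced c φ q))

  Decided-≅ : ∀ {n c p} {φ ψ : Formula S n} → φ ≅ ψ → Decided c φ p → Decided c ψ p
  Decided-≅ e (inj₁ f) = inj₁ λ w m p∈ → f w m (proj₂ (eval-≅ (str w) e _) p∈)
  Decided-≅ {c = c} e (inj₂ (q , p<q , f)) = inj₂ (q , p<q , Forced-≅ {c = c} e f)

  force : ∀ c {n} {φ : Formula S n} → φ ∈ formulas n → ∀ (q : ℚ[0,1]) w → Meets c w →
          ℚ[0,1].rat q ∈ lower (val (ev φ w)) →
          Σ[ c′ ∈ Condition ] (c′ ≼ c × Forced c′ φ (ℚ[0,1].rat q))
  force c {φ = distF _ _} φ∈ q w m q∈ = force-∈ c φ∈ q w m q∈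
  force c {φ = predF _ _} φ∈ q w m q∈ = force-∈ c φ∈ q w m q∈
  force c {φ = const _}   φ∈ q w m q∈ = force-∈ c φ∈ q w m q∈
  force c {φ = _ ⇒ _}     φ∈ q w m q∈ = force-∈ c φ∈ q w m q∈
  -- The part of a supremum below 0 cannot contain `q`, which is at least 0.
  force c {φ = supX φ}    φ∈ q w m (inj₁ q<0) = ⊥-elim (ℚₚ.<-irrefl refl (ℚₚ.<-≤-trans q<0 (ℚ[0,1].0≤rat q)))
  force c {φ = supN φs}   φ∈ q w m (inj₁ q<0) = ⊥-elim (ℚₚ.<-irrefl refl (ℚₚ.<-≤-trans q<0 (ℚ[0,1].0≤rat q)))
  force c {φ = supN φs}   φ∈ q w m (inj₂ (k , q∈)) =
    let c′ , c′≼c , f = force-∈ c (supN-sub φ∈ k) q w m q∈ in c′ , c′≼c , k , f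
  force c {n} {φ = supX φ} φ∈ q w m (inj₂ (a , q∈)) =
    let c′ , c′≼c , f = force-∈ c (subst-closed σ (supX-sub φ∈)) q w′
                          (subst (λ as → Pos (eval (str w) (formula c) as))
                            (sym (prefix-override (env w) K a (ℕₚ.m≤m+n (ctx c) n))) m)
                          (proj₂ (eval-σ w′)
                            (subst (λ as → ℚ[0,1].rat q ∈ lower (val (eval (str w) φ as)))
                              (cong₂ _∷_
                                (sym (trans (lookup-last w′) (override-≡ (env w) K a)))
                                (sym (prefix-override (env w) K a n≤K))) q∈))
    in c′ , c′≼c , (suc K , var (last K)) , λ v m → proj₁ (eval-σ v) (f v m)
    where
    -- `K` is a variable beyond the contexts of `c` and of `supX φ`: giving it the value `a` affects
    -- neither, and it becomes the name of the witness.
    K = ctx c ℕ.+ n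
    n≤K = ℕₚ.m≤n+m n (ctx c)
    n≤1+K = ℕₚ.m≤n⇒m≤1+n n≤K
    σ = var (last K) ∷ wk n≤1+K
    w′ = record { str = str w ; isModel = isModel w ; env = override (env w) K a }
    lookup-last : ∀ v → lookup (prefix (suc K) (env v)) (last K) ≡ env v K
    lookup-last v = trans (lookup∘tabulate (env v ∘ toℕ) (last K)) (cong (env v) (toℕ-fromℕ K))
    eval-σ : ∀ v → val (ev (substFormula σ φ) v) ≈
                   val (eval (str v) φ (⟦ suc K , var (last K) ⟧ v ∷ prefix n (env v)))
    eval-σ v = subst (λ as → val (ev (substFormula σ φ) v) ≈
                             val (eval (str v) φ (⟦ suc K , var (last K) ⟧ v ∷ as)))
      (evalTerms-wk (str v) n≤1+K (env v)) (eval-subst (str v) σ φ (prefix (suc K) (env v)))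

  ≼-refl : ∀ c → c ≼ c
  ≼-refl c w m = m

  -- If no world meeting `c` puts `φ` above `p`, then `c` itself refutes this; otherwise openness of
  -- the cut in such a world supplies `q`.
  decide : ∀ c {n} {φ : Formula S n} → φ ∈ formulas n → ∀ (p : ℚ[0,1]) →
           Σ[ c′ ∈ Condition ] (c′ ≼ c × Decided c′ φ (ℚ[0,1].rat p))
  decide c {φ = φ} φ∈ p with em {Σ[ w ∈ World ] (Meets c w × ℚ[0,1].rat p ∈ lower (val (ev φ w)))}
  ... | no ∄w = c , ≼-refl c , inj₁ λ w m p∈ → ∄w (w , m , p∈)
  ... | yes (w , m , p∈) =
    let q , p<q , q∈ = open′ (val (ev φ w)) p∈
        c′ , c′≼c , f = force c φ∈
          (mk q (ℚₚ.≤-trans (ℚ[0,1].0≤rat p) (ℚₚ.<⇒≤ p<q)) (ℚₚ.<⇒≤ (val≤1 (ev φ w) q∈))) w m q∈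
    in c′ , c′≼c , inj₂ (q , p<q , f)

  -- Forcing a tuple of terms to omit a type

  Omits : ∀ {k n} → Condition → Pred (Formula S k) 0ℓ → Vec (Term S n) k → Set₁
  Omits c Σ ts = Σ[ σ ∈ Formula S _ ] (Lift (lsuc 0ℓ) (σ ∈ Σ) × ∃[ q ] (q ℚ.< 1ℚ ×
                 c ⊩ λ w → q ∉ lower (val (eval (str w) σ (evT ts w)))))

  ¬1≤⇒∉ : ∀ (x : 𝕀) → ¬ (val x ≈ 1ℝ) → ∃[ q ] (q ℚ.< 1ℚ × q ∉ lower (val x))
  ¬1≤⇒∉ x ¬≈1 = stable λ ∄q → ¬≈1 (val≤1 x , λ {p} p<1 → stable λ p∉ → ∄q (p , p<1 , p∉))

  ¬Realizes⇒∉ : ∀ 𝓜 {k} {Σ : Pred (Formula S k) 0ℓ} {as} → ¬ Realizes 𝓜 Σ as →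
                Σ[ σ ∈ Formula S k ] (Lift (lsuc 0ℓ) (σ ∈ Σ) × ∃[ q ] (q ℚ.< 1ℚ × q ∉ lower (val (eval 𝓜 σ as))))
  ¬Realizes⇒∉ 𝓜 {k} {Σ} {as} ¬real
    with em {Σ[ σ ∈ Formula S k ] (Lift (lsuc 0ℓ) (σ ∈ Σ) × ∃[ q ] (q ℚ.< 1ℚ × q ∉ lower (val (eval 𝓜 σ as))))}
  ... | yes found = found
  ... | no ∄σ = ⊥-elim (¬real λ {σ} σ∈ → stable λ ¬sat → ∄σ (σ , lift σ∈ , ¬1≤⇒∉ (eval 𝓜 σ as) ¬sat))

  -- In some world meeting `c` the terms do not realize `Σ`, for otherwise `Σ` would be principal;
  -- there some `σ` stays below 1, and the new condition preserves this.
  omit : ∀ c {k n} {Σ : Pred (Formula S k) 0ℓ} → (∀ {σ} → σ ∈ Σ → σ ∈ formulas k) → ¬ Principal L T Σ →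
         (ts : Vec (Term S n) k) → Σ[ c′ ∈ Condition ] (c′ ≼ c × Omits c′ Σ ts)
  omit c {k} {n} {Σ} Σ⊆L ¬principal ts =
    let w , m , ¬real = counterexample
        σ , lift σ∈ , q , q<1 , q∉ = ¬Realizes⇒∉ (str w) ¬real
        -- `force-∉` needs a strict bound at `w`, hence a `q′` between `q` and 1.
        q′ , q<q′ , q′<1 = ℚₚ.<-dense q<1
        0≤q′ = ℚₚ.≤-trans (nonneg-∉ (eval (str w) σ (evT ts w)) q∉) (ℚₚ.<⇒≤ q<q′)
        c′ , c′≼c , f = force-∉ c (subst-closed ts (Σ⊆L σ∈)) (mk q′ 0≤q′ (ℚₚ.<⇒≤ q′<1)) w m
          (q , (λ q∈ → q∉ (proj₁ (eval-subst (str w) ts σ _) q∈)) , q<q′)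
    in c′ , c′≼c , σ , lift σ∈ , q′ , q′<1 , λ v m q′∈ → f v m (proj₂ (eval-subst (str v) ts σ _) q′∈)
    where
    m≤ = ℕₚ.m≤m+n (ctx c) n
    n≤ = ℕₚ.m≤n+m n (ctx c)
    K = ctx c ℕ.+ n
    γ = substFormula (wk m≤) (formula c)
    ts′ = substTerms (wk n≤) ts

    w₀ = world c
    0∈γ : Pos (ev γ w₀)
    0∈γ = proj₂ (ev-wk m≤ (formula c) w₀) (holds c)
    -- 0 < h < s, and `s` is below the value of `γ` at `w₀`; the threshold `r` is `1 - h`, strictly
    -- above `1 - s`.
    s-spec = open′ (val (ev γ w₀)) 0∈γ
    s = proj₁ s-spec
    0<s = proj₁ (proj₂ s-spec)
    s∈ = proj₂ (proj₂ s-spec)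
    s<1 = val≤1 (ev γ w₀) s∈
    h-spec = ℚₚ.<-dense 0<s
    h = proj₁ h-spec
    0<h = proj₁ (proj₂ h-spec)
    h<s = proj₂ (proj₂ h-spec)
    sF = mk s (ℚₚ.<⇒≤ 0<s) (ℚₚ.<⇒≤ s<1)
    r : ℚ⟨0,1⟩
    r = mk (1ℚ ℚ.- h)
      (<-diff (ℚₚ.<-trans h<s s<1) (solve 1 (λ h → con 1ℚ :- h :- con 0ℚ := con 1ℚ :- h) refl h))
      (<-diff 0<h (solve 1 (λ h → con 1ℚ :- (con 1ℚ :- h) := h :- con 0ℚ) refl h))

    at-w₀ : Satisfies (str w₀) (const sF ⇒ γ) (prefix K (env w₀))
    at-w₀ = proj₂ , λ p<1 → ⇛⁺ (fromℚ[0,1] sF) (ev γ w₀) p<1 (ℚₚ.<-irrefl refl) s∈ (ℚₚ.+-monoˡ-< s p<1)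

    -- At threshold 1 - h the value of `γ` is at least s - h, which is positive.
    pos-γ : ∀ 𝓜 bs → real r ≤ val (eval 𝓜 (const sF ⇒ γ) bs) → Pos (eval 𝓜 γ bs)
    pos-γ 𝓜 bs r≤ =
      let p , h<p , p<s = ℚₚ.<-dense h<s
          _ , u , b , s≤u , b∈ , lt = ⇛⁻ (fromℚ[0,1] sF) (eval 𝓜 γ bs) (r≤ {1ℚ ℚ.- p}
            (<-diff h<p (solve 2 (λ h p → con 1ℚ :- h :- (con 1ℚ :- p) := p :- h) refl h p)))
      in downClosed (val (eval 𝓜 γ bs)) (ℚₚ.<⇒≤ (<-diff (lt +< ℚₚ.<-≤-trans p<s (ℚₚ.≮⇒≥ s≤u))
           (solve 3 (λ b p u → b :- con 0ℚ := con 1ℚ :+ b :+ u :- (con 1ℚ :- p :+ u :+ p)) refl b p u))) b∈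

    Counter : Set₁
    Counter = Σ[ w ∈ World ] (Meets c w × ¬ Realizes (str w) Σ (evT ts w))

    realizes : ¬ Counter → ∀ 𝓜 → IsModel 𝓜 T → ∀ bs → real r ≤ val (eval 𝓜 (const sF ⇒ γ) bs) →
               Realizes 𝓜 Σ (evalTerms 𝓜 bs ts′)
    realizes ∄w 𝓜 𝓜⊨T bs r≤ {σ} σ∈ = stable λ ¬sat →
      let b , eq = prefix-extension (nonempty 𝓜) bs
          w = record { str = 𝓜 ; isModel = 𝓜⊨T ; env = b }
      in ∄w (w
            , proj₁ (ev-wk m≤ (formula c) w)
                (subst (λ as → Pos (eval 𝓜 γ as)) (sym eq) (pos-γ 𝓜 bs r≤))
            , λ real → ¬sat (subst (Satisfies 𝓜 σ)
                (sym (trans (evalTerms-subst 𝓜 (wk n≤) bs ts)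
                  (cong (λ as → evalTerms 𝓜 as ts)
                    (trans (cong (λ as → evalTerms 𝓜 as (wk n≤)) (sym eq)) (evalTerms-wk 𝓜 n≤ b)))))
                (real σ∈)))

    counterexample : Counter
    counterexample with em {Counter}
    ... | yes found = found
    ... | no ∄w = ⊥-elim (¬principal (record
      { φ = const sF ⇒ γ
      ; φ∈L = ⇒-closed (has-const sF) (subst-closed (wk m≤) (inL c))
      ; ts = ts′
      ; r = r
      ; satisfiable = str w₀ , isModel w₀ , prefix K (env w₀) , at-w₀
      ; entails = λ 𝓜 𝓜⊨T bs r≤ → realizes ∄w 𝓜 𝓜⊨T bs r≤
      }))

-- The generic model

-- Walks the antidiagonal `a + b = s` from `(0 , s)` to `(s , 0)` and then moves on to the next one:
-- Cantor's enumeration of pairs.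
next : ℕ × ℕ → ℕ × ℕ
next (a , zero)  = zero , suc a
next (a , suc b) = suc a , b

unpair : ℕ → ℕ × ℕ
unpair zero    = zero , zero
unpair (suc n) = next (unpair n)

unpair-surjective : ∀ p → ∃[ n ] unpair n ≡ p
unpair-surjective (a , b) = diagonal (a ℕ.+ b) a b refl
  where
  diagonal : ∀ s a b → a ℕ.+ b ≡ s → ∃[ n ] unpair n ≡ (a , b)
  diagonal s       (suc a) b       eq =
    let n , eq′ = diagonal s a (suc b) (trans (ℕₚ.+-suc a b) eq) in suc n , cong next eq′
  diagonal zero    zero    zero    eq = zero , refl
  diagonal (suc s) zero    (suc b) eq =
    let n , eq′ = diagonal s b zero (trans (ℕₚ.+-identityʳ b) (ℕₚ.suc-injective eq)) in suc n , cong next eq′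

-- The generic chain of conditions

module Generic
  (em : ExcludedMiddle (lsuc 0ℓ)) {S : Signature} (L : Fragment S) (countable : Countable L)
  (T : Pred (Formula S 0) 0ℓ) (arity : ℕ → ℕ) (Σs : ∀ n → Pred (Formula S (arity n)) 0ℓ)
  (Σs⊆L : ∀ n {σ} → σ ∈ Σs n → σ ∈ Fragment.formulas L (arity n))
  (¬principal : ∀ n → ¬ Principal L T (Σs n))
  (w₀ : Forcing.World em L T) where

  open Classical em
  open Fragment L
  open Forcing em L T
  open World
  open Structure using (Carrier; nonempty; dist; funI; predI; conI; isMetric)

  enum : ∀ n → ℕ → Formula S n
  enum n = proj₁ (countable n)

  -- The countability of L is all that is known about the signature, so a tuple of terms is
  -- enumerated through a formula, and likewise a pair (p, φ) as const p ⇒ φ.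
  encode : ∀ {n k} → Vec (Term S n) k → Formula S n
  encode []       = const 0F
  encode (t ∷ ts) = distF t t ⇒ encode ts

  encode∈L : ∀ {n k} (ts : Vec (Term S n) k) → encode ts ∈ formulas n
  encode∈L []       = has-const 0F
  encode∈L (t ∷ ts) = ⇒-closed (has-distF t t) (encode∈L ts)

  encode-injective : ∀ {n k} {ts us : Vec (Term S n) k} → encode ts ≅ encode us → ts ≡ us
  encode-injective {ts = []}     {[]}     e = refl
  encode-injective {ts = t ∷ ts} {u ∷ us} (distF ⇒ e) = cong (t ∷_) (encode-injective e)

  -- Index 0 asks for a decision and index `suc i` for the omission of `Σs i`; if `enum n k` does
  -- not encode a task of that kind, the requirement is vacuous.
  Requirement : ℕ → ℕ → ℕ → Condition → Set₁
  Requirement zero    n k c = ∀ {p φ} → enum n k ≅ const p ⇒ φ → φ ∈ formulas n → Decided c φ (ℚ[0,1].rat p)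
  Requirement (suc i) n k c = ∀ {ts : Vec (Term S n) (arity i)} → enum n k ≅ encode ts → Omits c (Σs i) ts

  meet : ∀ i n k c → Σ[ c′ ∈ Condition ] (c′ ≼ c × Requirement i n k c′)
  meet zero n k c
    with em {Σ[ p ∈ ℚ[0,1] ] Σ[ φ ∈ Formula S n ] Lift (lsuc 0ℓ) (enum n k ≅ const p ⇒ φ × φ ∈ formulas n)}
  ... | no none = c , ≼-refl c , λ e φ∈ → ⊥-elim (none (_ , _ , lift (e , φ∈)))
  ... | yes (p , φ , lift (e , φ∈)) =
    let c′ , c′≼c , d = decide c φ∈ p
    -- The code determines the task up to `≅`, so a single decision serves every decoding of it.
    in c′ , c′≼c , λ e′ _ → transport {c′} d (≅-trans (≅-sym e) e′)
    where
    transport : ∀ {c′ p p′ φ φ′} → Decided c′ φ (ℚ[0,1].rat p) → const p ⇒ φ ≅ const p′ ⇒ φ′ →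
                Decided c′ φ′ (ℚ[0,1].rat p′)
    transport {c′} d (const ⇒ e) = Decided-≅ {c = c′} e d
  meet (suc i) n k c
    with em {Σ[ ts ∈ Vec (Term S n) (arity i) ] Lift (lsuc 0ℓ) (enum n k ≅ encode ts)}
  ... | no none = c , ≼-refl c , λ e → ⊥-elim (none (_ , lift e))
  ... | yes (ts , lift e) =
    let c′ , c′≼c , o = omit c (Σs⊆L i) (¬principal i) ts
    in c′ , c′≼c , λ e′ → subst (Omits c′ (Σs i)) (encode-injective (≅-trans (≅-sym e) e′)) o

  start : Condition
  start = record
    { formula = const {n = 0} 1F ; inL = has-const 1F ; world = w₀ ; holds = 0<1 }

  meetCode : ℕ → Condition → Condition
  meetCode j c =
    let i , l = unpair j
        n , k = unpair l
    in proj₁ (meet i n k c)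

  chain : ℕ → Condition
  chain zero    = start
  chain (suc j) = meetCode j (chain j)

  chain-suc : ∀ j → chain (suc j) ≼ chain j
  chain-suc j =
    let i , l = unpair j
        n , k = unpair l
    in proj₁ (proj₂ (meet i n k (chain j)))

  chain-anti : ∀ {i j} → i ℕ.≤′ j → chain j ≼ chain i
  chain-anti ℕ.≤′-refl w m = m
  chain-anti {j = suc j} (ℕ.≤′-step i≤j) w m = chain-anti i≤j w (chain-suc j w m)

  -- Step `j` treats the task with code `j`, so its requirement holds at `chain (suc j)`.
  generic : ∀ i n k → ∃[ j ] Requirement i n k (chain j)
  generic i n k =
    let l , l-eq = unpair-surjective (n , k)
        j , j-eq = unpair-surjective (i , l)
    in suc j , subst (λ (i′ , l′) → let n′ , k′ = unpair l′ in Requirement i n k (proj₁ (meet i′ n′ k′ (chain j))))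
         (sym j-eq)
         (subst (λ (n′ , k′) → Requirement i n k (proj₁ (meet i n′ k′ (chain j)))) (sym l-eq)
           (proj₂ (proj₂ (meet i n k (chain j)))))

  -- Statements forced along the chain

  □ : (World → Set) → Set₁
  □ P = ∃[ k ] chain k ⊩ P

  □-pure : ∀ {P} → (∀ w → P w) → □ P
  □-pure p = zero , λ w _ → p w

  □-map : ∀ {P Q} → (∀ w → P w → Q w) → □ P → □ Q
  □-map f (k , p) = k , λ w m → f w (p w m)

  -- Forced statements form a filter: two stages are replaced by the later one, the chain being
  -- decreasing.
  □-zip : ∀ {P Q R} → (∀ w → P w → Q w → R w) → □ P → □ Q → □ R
  □-zip f (i , p) (j , q) = i ℕ.⊔ j , λ w m →
    f w (p w (chain-anti (ℕₚ.≤⇒≤′ (ℕₚ.m≤m⊔n i j)) w m)) (q w (chain-anti (ℕₚ.≤⇒≤′ (ℕₚ.m≤n⊔m i j)) w m))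

  -- Each condition is met in its own world; this makes the filter proper and lets estimates proved
  -- inside worlds be used outside.
  □-extract : ∀ {A} → □ (λ _ → A) → A
  □-extract (k , p) = p (Condition.world (chain k)) (Condition.holds (chain k))

  □-∀ : ∀ {n} {P : Fin n → World → Set} → (∀ i → □ (P i)) → □ (λ w → ∀ i → P i w)
  □-∀ {zero}  p = □-pure (λ w ())
  □-∀ {suc n} p = □-zip (λ { w p₀ ps zero → p₀ ; w p₀ ps (suc i) → ps i }) (p zero) (□-∀ (p ∘ suc))

  Settled : (World → 𝕀) → Set₁
  Settled f = ∀ p → □ (λ w → p ∉ lower (val (f w))) ⊎ (∃[ q ] (p ℚ.< q × □ (λ w → q ∈ lower (val (f w)))))

  decided : ∀ {n φ} → φ ∈ formulas n → ∀ p → ∃[ j ] Decided (chain j) φ (ℚ[0,1].rat p)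
  decided {n} {φ} φ∈ p =
    let k , e = proj₂ (countable n) (⇒-closed (has-const p) φ∈)
        j , req = generic 0 n k
    in j , req e φ∈

  -- The chain decides only bounds in [0,1]. Below 0 the bound holds without a witness, which the
  -- alternative `q < 0` records; above 1 it always fails.
  settled-or : ∀ {n φ} → φ ∈ formulas n → ∀ p →
               □ (λ w → p ∉ lower (val (ev φ w))) ⊎
               (∃[ q ] (p ℚ.< q × ∃[ j ] (Forced (chain j) φ q ⊎ q ℚ.< 0ℚ)))
  settled-or {φ = φ} φ∈ p with p ℚₚ.<? 0ℚ
  ... | yes p<0 = let q , p<q , q<0 = ℚₚ.<-dense p<0 in inj₂ (q , p<q , zero , inj₂ q<0)
  ... | no p≮0 with p ℚₚ.≤? 1ℚ
  ...   | no p≰1 = inj₁ (□-pure (λ w p∈ → p≰1 (ℚₚ.<⇒≤ (val≤1 (ev φ w) p∈))))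
  ...   | yes p≤1 with decided φ∈ (mk p (ℚₚ.≮⇒≥ p≮0) p≤1)
  ...     | j , inj₁ f             = inj₁ (j , f)
  ...     | j , inj₂ (q , p<q , f) = inj₂ (q , p<q , j , inj₁ f)

  settled : ∀ {n φ} → φ ∈ formulas n → Settled (ev φ)
  settled {φ = φ} φ∈ p with settled-or φ∈ p
  ... | inj₁ f                        = inj₁ f
  ... | inj₂ (q , p<q , j , inj₁ f)   = inj₂ (q , p<q , j , Forced⇒∈ (chain j) φ f)
  ... | inj₂ (q , p<q , j , inj₂ q<0) = inj₂ (q , p<q , □-pure (λ w → 0≤val (ev φ w) q<0))

  forced : ∀ {n φ} → φ ∈ formulas n → ∀ {p} → □ (λ w → p ∈ lower (val (ev φ w))) →
           (∃[ q ] (p ℚ.< q × ∃[ j ] (Forced (chain j) φ q ⊎ q ℚ.< 0ℚ)))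
  forced φ∈ {p} p∈ with settled-or φ∈ p
  ... | inj₁ p∉ = ⊥-elim (□-extract (□-zip (λ w p∉ p∈ → p∉ p∈) p∉ p∈))
  ... | inj₂ f  = f

  Settled-≈ : ∀ f g → (∀ w → val (f w) ≈ val (g w)) → Settled f → Settled g
  Settled-≈ f g eq s p with s p
  ... | inj₁ p∉             = inj₁ (□-map (λ w p∉ p∈ → p∉ (proj₂ (eq w) p∈)) p∉)
  ... | inj₂ (q , p<q , q∈) = inj₂ (q , p<q , □-map (λ w → proj₁ (eq w)) q∈)

  -- □ quantifies over all structures and so lives in Set₁, whereas lower cuts are Set-valued.
  ⌊_⌋ : Set₁ → Set
  ⌊ P ⌋ = Bool.T (does (em {P}))

  ⌊⌋⁺ : ∀ {P} → P → ⌊ P ⌋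
  ⌊⌋⁺ {P} p with em {P}
  ... | yes _ = tt
  ... | no ¬p = ⊥-elim (¬p p)

  ⌊⌋⁻ : ∀ {P} → ⌊ P ⌋ → P
  ⌊⌋⁻ {P} t with em {P}
  ... | yes p = p

  -- Limits of values along the chain

  □⊎□∉ : ∀ f → Settled f → ∀ {p} → ¬ □ (λ w → p ∈ lower (val (f w))) → □ (λ w → p ∉ lower (val (f w)))
  □⊎□∉ f s {p} ¬p∈ with s p
  ... | inj₁ p∉             = p∉
  ... | inj₂ (q , p<q , q∈) = ⊥-elim (¬p∈ (□-map (λ w → downClosed (val (f w)) (ℚₚ.<⇒≤ p<q)) q∈))

  open□ : ∀ f → Settled f → ∀ {p} → □ (λ w → p ∈ lower (val (f w))) →
          ∃[ q ] (p ℚ.< q × □ (λ w → q ∈ lower (val (f w))))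
  open□ f s {p} p∈ with s p
  ... | inj₁ p∉ = ⊥-elim (□-extract (□-zip (λ w p∉ p∈ → p∉ p∈) p∉ p∈))
  ... | inj₂ q  = q

  -- The value of `f` at the generic filter: its cut consists of the `p` forced to lie below `f`.
  -- Settledness makes this cut open.
  limit : ∀ f → Settled f → 𝕀
  limit f s = record
    { val = record
      { lower      = λ p → ⌊ □ (λ w → p ∈ lower (val (f w))) ⌋
      ; inhabited  = ℚ.- 1ℚ , ⌊⌋⁺ (□-pure (λ w → 0≤val (f w) (ℚₚ.negative⁻¹ (ℚ.- 1ℚ))))
      ; bounded    = 1ℚ , λ m → □-extract (□-map (λ w 1∈ → ℚₚ.<-irrefl refl (val≤1 (f w) 1∈)) (⌊⌋⁻ m))
      ; downClosed = λ p≤q m → ⌊⌋⁺ (□-map (λ w → downClosed (val (f w)) p≤q) (⌊⌋⁻ m))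
      ; open′      = λ m → let q , p<q , q∈ = open□ f s (⌊⌋⁻ m) in q , p<q , ⌊⌋⁺ q∈
      }
    ; 0≤val = λ p<0 → ⌊⌋⁺ (□-pure (λ w → 0≤val (f w) p<0))
    ; val≤1 = λ m → □-extract (□-map (λ w → val≤1 (f w)) (⌊⌋⁻ m))
    }

  -- By `∉⁻`, what fails in the limit is refuted at some stage; thus upper bounds can be carried to
  -- the worlds as well as lower bounds.
  record _tracks_ (x : 𝕀) (f : World → 𝕀) : Set₁ where
    field
      ∈⁺ : ∀ {p} → □ (λ w → p ∈ lower (val (f w))) → p ∈ lower (val x)
      ∈⁻ : ∀ {p} → p ∈ lower (val x) → □ (λ w → p ∈ lower (val (f w)))
      ∉⁻ : ∀ {p} → p ∉ lower (val x) → □ (λ w → p ∉ lower (val (f w)))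

  open _tracks_

  limit-tracks : ∀ f s → limit f s tracks f
  limit-tracks f s = record { ∈⁺ = ⌊⌋⁺ ; ∈⁻ = ⌊⌋⁻ ; ∉⁻ = λ p∉ → □⊎□∉ f s (λ m → p∉ (⌊⌋⁺ m)) }

  tracks-resp : ∀ {x f g} → □ (λ w → val (f w) ≈ val (g w)) → x tracks f → x tracks g
  tracks-resp eq t = record
    { ∈⁺ = λ m → ∈⁺ t (□-zip (λ w (_ , g≤f) → g≤f) eq m)
    ; ∈⁻ = λ m → □-zip (λ w (f≤g , _) → f≤g) eq (∈⁻ t m)
    ; ∉⁻ = λ m → □-zip (λ w (_ , g≤f) p∉ p∈ → p∉ (g≤f p∈)) eq (∉⁻ t m)
    }

  -- Points of the generic model

  ⟦_⟧* : ∀ {k} → Vec Elem k → (w : World) → Vec (Carrier (str w)) k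
  ⟦ xs ⟧* w = map (λ x → ⟦ x ⟧ w) xs

  -- Every element carries its own context; the sum of the contexts accommodates finitely many of
  -- them.
  common : ∀ {k} (xs : Vec Elem k) →
           Σ[ n ∈ ℕ ] Σ[ ts ∈ Vec (Term S n) k ] (∀ w → evT ts w ≡ ⟦ xs ⟧* w)
  common []             = 0 , [] , λ w → refl
  common ((m , t) ∷ xs) =
    let n , ts , eq = common xs
        m≤ = ℕₚ.m≤m+n m n
        n≤ = ℕₚ.m≤n+m n m
    in m ℕ.+ n , substTerm (wk m≤) t ∷ substTerms (wk n≤) ts , λ w → cong₂ _∷_
         (trans (evalTerm-subst (str w) (wk m≤) _ t)
           (cong (λ as → evalTerm (str w) as t) (evalTerms-wk (str w) m≤ (env w))))
         (trans (evalTerms-subst (str w) (wk n≤) _ ts)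
           (trans (cong (λ as → evalTerms (str w) as ts) (evalTerms-wk (str w) n≤ (env w))) (eq w)))

  infix 4 _∼_

  _∼_ : Elem → Elem → Set₁
  x ∼ y = □ (λ w → ⟦ x ⟧ w ≡ ⟦ y ⟧ w)

  ∼-sym : ∀ {x y} → x ∼ y → y ∼ x
  ∼-sym = □-map (λ w → sym)

  ∼-trans : ∀ {x y z} → x ∼ y → y ∼ z → x ∼ z
  ∼-trans = □-zip (λ w → trans)

  -- The term enters the enumeration of the fragment through `distF t t`, whose position is paired
  -- with the context.
  code : Elem → ℕ
  code (n , t) = proj₁ (unpair-surjective (n , proj₁ (proj₂ (countable n) (has-distF t t))))

  code-injective : ∀ {x y} → code x ≡ code y → x ≡ y
  code-injective {m , t} {n , u} eq = same (proj₂ (proj₂ (countable m) (has-distF t t)))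
                                           (proj₂ (proj₂ (countable n) (has-distF u u)))
    (trans (sym (proj₂ (unpair-surjective _))) (trans (cong unpair eq) (proj₂ (unpair-surjective _))))
    where
    distF-injective : ∀ {n} {t u : Term S n} → distF t t ≅ distF u u → t ≡ u
    distF-injective distF = refl
    same : ∀ {m n k l} {t : Term S m} {u : Term S n} → enum m k ≅ distF t t → enum n l ≅ distF u u →
           (m , k) ≡ (n , l) → _≡_ {A = Elem} (m , t) (n , u)
    same e e′ refl = cong (_ ,_) (distF-injective (≅-trans (≅-sym e) e′))

  -- Points must be equal as soon as their distance is 0; in the absence of quotients each
  -- class is represented by its element of least code.
  Canonical : Elem → Set₁
  Canonical x = ∀ y → x ∼ y → code x ℕ.≤ code y

  Point : Set
  Point = Σ[ x ∈ Elem ] ⌊ Canonical x ⌋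

  rep : Point → Elem
  rep = proj₁

  -- Equivalent representatives of least code have equal codes and so coincide; their proofs of
  -- canonicity agree because `⌊_⌋` has at most one proof.
  point-≡ : ∀ {a b} → rep a ∼ rep b → a ≡ b
  point-≡ {x , cx} {y , cy} x∼y =
    same (code-injective (ℕₚ.≤-antisym (⌊⌋⁻ {Canonical x} cx y x∼y)
                                        (⌊⌋⁻ {Canonical y} cy x (∼-sym {x} {y} x∼y)))) cx cy
    where
    same : ∀ {x y} → x ≡ y → (cx : ⌊ Canonical x ⌋) (cy : ⌊ Canonical y ⌋) → _≡_ {A = Point} (x , cx) (y , cy)
    same refl cx cy = cong (_ ,_) (T-irrelevant cx cy)

  canonical : ∀ x → Σ[ a ∈ Point ] (rep a ∼ x)
  canonical x = search x (<-wellFounded (code x))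
    where
    search : ∀ x → Acc ℕ._<_ (code x) → Σ[ a ∈ Point ] (rep a ∼ x)
    search x (acc smaller) with em {Σ[ y ∈ Elem ] (x ∼ y × Lift (lsuc 0ℓ) (code y ℕ.< code x))}
    ... | yes (y , x∼y , lift lt) = let a , a∼y = search y (smaller lt) in
                                     a , ∼-trans {rep a} {y} {x} a∼y (∼-sym {x} {y} x∼y)
    ... | no least = (x , ⌊⌋⁺ λ y x∼y → ℕₚ.≮⇒≥ (λ lt → least (y , x∼y , lift lt))) , □-pure (λ w → refl)

  ⟪_⟫ : Point → (w : World) → Carrier (str w)
  ⟪ a ⟫ = ⟦ rep a ⟧

  ⟪_⟫* : ∀ {k} → Vec Point k → (w : World) → Vec (Carrier (str w)) k
  ⟪ as ⟫* w = map (λ a → ⟪ a ⟫ w) as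

  common-points : ∀ {k} (as : Vec Point k) →
                  Σ[ n ∈ ℕ ] Σ[ ts ∈ Vec (Term S n) k ] (∀ w → evT ts w ≡ ⟪ as ⟫* w)
  common-points as = let n , ts , eq = common (map rep as) in
    n , ts , λ w → trans (eq w) (sym (map-∘ (λ x → ⟦ x ⟧ w) rep as))

  -- Substituting terms for the points turns the value into that of a formula of `L`, which the
  -- chain settles.
  settled-at : ∀ {k φ} → φ ∈ formulas k → (as : Vec Point k) → Settled (λ w → eval (str w) φ (⟪ as ⟫* w))
  settled-at {φ = φ} φ∈ as =
    let n , ts , eq = common-points as
    in Settled-≈ (ev (substFormula ts φ)) (λ w → eval (str w) φ (⟪ as ⟫* w))
         (λ w → subst (λ bs → val (ev (substFormula ts φ) w) ≈ val (eval (str w) φ bs)) (eq w)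
                   (eval-subst (str w) ts φ _))
         (settled (subst-closed ts φ∈))

  -- Distances, predicates and functions on points

  distW : Point → Point → World → 𝕀
  distW a b w = dist (str w) (⟪ a ⟫ w) (⟪ b ⟫ w)

  predW : ∀ P → Vec Point (Signature.predArity S P) → World → 𝕀
  predW P as w = predI (str w) P (⟪ as ⟫* w)

  dist-settled : ∀ a b → Settled (distW a b)
  dist-settled a b = settled-at (has-distF (var zero) (var (suc zero))) (a ∷ b ∷ [])

  pred-settled : ∀ P as → Settled (predW P as)
  pred-settled P as =
    let n , ts , eq = common-points as
    in Settled-≈ (ev (predF P ts)) (predW P as)
         (λ w → ≈-reflexive (cong (predI (str w) P) (eq w))) (settled (has-predF P ts))

  distP : Point → Point → 𝕀
  distP a b = limit (distW a b) (dist-settled a b)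

  predP : ∀ P → Vec Point (Signature.predArity S P) → 𝕀
  predP P as = limit (predW P as) (pred-settled P as)

  funE : ∀ f → Vec Point (Signature.funArity S f) → Elem
  funE f as = let n , ts , _ = common-points as in n , app f ts

  funE-eval : ∀ f as w → ⟦ funE f as ⟧ w ≡ funI (str w) f (⟪ as ⟫* w)
  funE-eval f as w = cong (funI (str w) f) (proj₂ (proj₂ (common-points as)) w)

  funP : ∀ f → Vec Point (Signature.funArity S f) → Point
  funP f as = proj₁ (canonical (funE f as))

  funP-eval : ∀ f as → □ (λ w → ⟪ funP f as ⟫ w ≡ funI (str w) f (⟪ as ⟫* w))
  funP-eval f as = □-map (λ w eq → trans eq (funE-eval f as w)) (proj₂ (canonical (funE f as)))

  distP-tracks : ∀ a b → distP a b tracks distW a b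
  distP-tracks a b = limit-tracks (distW a b) (dist-settled a b)

  predP-tracks : ∀ P as → predP P as tracks predW P as
  predP-tracks P as = limit-tracks (predW P as) (pred-settled P as)

  dist-0 : ∀ (𝓜 : Structure S) a → val (dist 𝓜 a a) ≤ 0ℝ
  dist-0 𝓜 a = proj₁ (Metric.IsGeneralMetric.≈⇒0 (isMetric 𝓜) refl)

  supP : ∀ {k} → Vec Point k → Vec Point k → 𝕀
  supP as bs = ⋁ (λ i → distP (lookup as i) (lookup bs i))

  -- Only finitely many coordinates occur, so one stage bounds all of them at once.
  supP-∉ : ∀ {k} (as bs : Vec Point k) {p} → p ∉ lower (val (supP as bs)) →
           □ (λ w → p ∉ lower (Structure.supDist (str w) (⟪ as ⟫* w) (⟪ bs ⟫* w)))
  supP-∉ as bs {p} p∉ = □-map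
    (λ { w d (inj₁ p<0) → p∉ (inj₁ p<0)
       ; w d (inj₂ (i , m)) → d i (subst₂ (λ a b → p ∈ lower (val (dist (str w) a b)))
           (lookup-map i (λ a → ⟪ a ⟫ w) as) (lookup-map i (λ a → ⟪ a ⟫ w) bs) m) })
    (□-∀ (λ i → ∉⁻ (distP-tracks (lookup as i) (lookup bs i)) (λ m → p∉ (inj₂ (i , m)))))

  triangleP : ∀ a b c → val (distP a c) ≤ val (distP a b) + val (distP b c)
  triangleP a b c {p} m =
    -- The slack between `p` and `q` is divided at `h` between the approximations of the two
    -- distances; their upper bounds meet the triangle inequality of a single world.
    let q , p<q , q∈ = open′ (val (distP a c)) m
        h , p<h , h<q = ℚₚ.<-dense p<q
        α , α∈ , α+η∉ = approx (val (distP a b)) (<⇒0<- p<h)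
        β , β∈ , β+η∉ = approx (val (distP b c)) (<⇒0<- h<q)
    in α , β , α∈ , β∈ , □-extract
         (□-zip (λ w (α+η∉ , β+η∉) q∈ →
             let u , v , u∈ , v∈ , q<u+v =
                   Metric.IsGeneralMetric.triangle (isMetric (str w)) (⟪ a ⟫ w) (⟪ b ⟫ w) (⟪ c ⟫ w) q∈
             in <-diff (q<u+v +< below-outside (val (distW a b w)) u∈ α+η∉
                               +< below-outside (val (distW b c w)) v∈ β+η∉)
                  (solve 7 (λ p q h α β u v → α :+ β :- p :=
                      u :+ v :+ (α :+ (h :- p)) :+ (β :+ (q :- h)) :- (q :+ u :+ v)) refl p q h α β u v))
           (□-zip (λ w → _,_) (∉⁻ (distP-tracks a b) α+η∉) (∉⁻ (distP-tracks b c) β+η∉))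
           (∈⁻ (distP-tracks a c) q∈))

  sub-tracks : ∀ {x y f g} → x tracks f → y tracks g → ∀ {p} → p ∈ lower (val x - val y) →
               □ (λ w → p ∈ lower (val (f w) - val (g w)))
  sub-tracks {x} {y} {f} {g} t s p∈ =
    let a , u , a∈ , u∉ , lt = ∈-sub⁻ (val x) (val y) p∈
    in □-zip (λ w a∈ u∉ → ∈-sub⁺ (val (f w)) (val (g w)) a∈ u∉ lt) (∈⁻ t a∈) (∉⁻ s u∉)

  model : Structure S
  model = record
    { Carrier  = Point
    ; nonempty = proj₁ (canonical (1 , var zero))
    ; dist     = distP
    ; isMetric = record
      { isSemiMetric = record
        { isQuasiSemiMetric = record
          { isPreMetric = record
            { isProtoMetric = record
              { isPartialOrder  = ≤-isPartialOrder
              ; ≈-isEquivalence = isEquivalence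
              ; cong            = λ { {a} {_} {b} refl refl → ≈-refl (val (distP a b)) }
              ; nonNegative     = λ {a} {b} → 0≤val (distP a b)
              }
            ; ≈⇒0 = λ { {a} refl →
                (λ m → □-extract (□-map (λ w → dist-0 (str w) (⟪ a ⟫ w)) (∈⁻ (distP-tracks a a) m)))
                , 0≤val (distP a a) }
            }
          -- If the limit distance is 0, some stage forces the distance to be 0, hence the two
          -- elements to be equal, which is `∼`.
          ; 0⇒≈ = λ {a} {b} d≈0 → point-≡ (□-map
              (λ w 0∉ → Metric.IsGeneralMetric.0⇒≈ (isMetric (str w))
                ( (λ {p} p∈ → ℚₚ.≰⇒> (λ 0≤p → 0∉ (downClosed (val (distW a b w)) 0≤p p∈)))
                , 0≤val (dist (str w) _ _)))
              (∉⁻ (distP-tracks a b) (λ 0∈ → ℚₚ.<-irrefl refl (proj₁ d≈0 0∈))))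
          }
        ; sym = λ a b → symP a b , symP b a
        }
      ; triangle = triangleP
      }
    ; funI  = funP
    ; predI = predP
    ; conI  = λ c → proj₁ (canonical (0 , con c))
    -- The strict bound `p` on the distance of the arguments carries over to the worlds of some
    -- stage; the modulus of any one of these structures then gives the estimate.
    ; funI-modulus = λ f ε as bs (p , p∉ , p<δ) m → □-extract
        (□-zip (λ w far near → Structure.funI-modulus (str w) f ε _ _ (_ , far , p<δ) near) (supP-∉ as bs p∉)
          (□-zip (λ w (eqa , eqb) → subst₂ (λ a b → _ ∈ lower (val (dist (str w) a b))) eqa eqb)
            (□-zip (λ w → _,_) (funP-eval f as) (funP-eval f bs))
            (∈⁻ (distP-tracks (funP f as) (funP f bs)) m)))
    ; predI-modulus = λ P ε as bs (p , p∉ , p<δ) m → □-extract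
        (□-zip (λ w far near → Structure.predI-modulus (str w) P ε _ _ (_ , far , p<δ) near) (supP-∉ as bs p∉)
          (abs-tracks (predP-tracks P as) (predP-tracks P bs) m))
    }
    where
    symP : ∀ a b → val (distP a b) ≤ val (distP b a)
    symP a b m = ∈⁺ (distP-tracks b a) (□-map
      (λ w → proj₁ (Metric.IsGeneralMetric.sym (isMetric (str w)) _ _)) (∈⁻ (distP-tracks a b) m))
    abs-tracks : ∀ {x y f g} → x tracks f → y tracks g → ∀ {p} → p ∈ lower ∣ val x - val y ∣ →
                 □ (λ w → p ∈ lower ∣ val (f w) - val (g w) ∣)
    abs-tracks t s (inj₁ m) = □-map (λ w → inj₁) (sub-tracks t s m)
    -- `- (x - y)` is handled as `y - x`, whose members are described by bounds that `tracks`
    -- transfers.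
    abs-tracks {x} {y} {f} {g} t s (inj₂ m) = □-map (λ w p∈ → inj₂ (sub≤neg-sub (val (f w)) (val (g w)) p∈))
      (sub-tracks s t (neg-sub≤ (val x) (val y) m))

  -- Truth in the generic model

  mutual
    term-tracks : ∀ {k} (as : Vec Point k) t →
                  □ (λ w → ⟪ evalTerm model as t ⟫ w ≡ evalTerm (str w) (⟪ as ⟫* w) t)
    term-tracks as (var i)    = □-pure (λ w → sym (lookup-map i (λ a → ⟪ a ⟫ w) as))
    term-tracks as (con c)    = proj₂ (canonical (0 , con c))
    term-tracks as (app f ts) = □-zip (λ w eq eqs → trans eq (cong (funI (str w) f) eqs))
      (funP-eval f (evalTerms model as ts)) (terms-track as ts)

    terms-track : ∀ {k l} (as : Vec Point k) (ts : Vec (Term S k) l) →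
                  □ (λ w → ⟪ evalTerms model as ts ⟫* w ≡ evalTerms (str w) (⟪ as ⟫* w) ts)
    terms-track as []       = □-pure (λ w → refl)
    terms-track as (t ∷ ts) = □-zip (λ w → cong₂ _∷_) (term-tracks as t) (terms-track as ts)

  -- What is not forced to lie below a settled value is refuted at some stage, so `∉⁻` comes from
  -- `∈⁺`.
  tracks-intro : ∀ {x f} → Settled f →
                 (∀ {p} → □ (λ w → p ∈ lower (val (f w))) → p ∈ lower (val x)) →
                 (∀ {p} → p ∈ lower (val x) → □ (λ w → p ∈ lower (val (f w)))) → x tracks f
  tracks-intro {f = f} s ∈⁺ ∈⁻ = record { ∈⁺ = ∈⁺ ; ∈⁻ = ∈⁻ ; ∉⁻ = λ p∉ → □⊎□∉ f s (λ m → p∉ (∈⁺ m)) }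

  ⇛-tracks : ∀ {x y f g} → Settled (λ w → f w ⇛ g w) → x tracks f → y tracks g →
             (x ⇛ y) tracks (λ w → f w ⇛ g w)
  ⇛-tracks {x} {y} {f} {g} st t s = tracks-intro {x ⇛ y} {λ w → f w ⇛ g w} st from to
    where
    to : ∀ {p} → p ∈ lower (val (x ⇛ y)) → □ (λ w → p ∈ lower (val (f w ⇛ g w)))
    to m = let p<1 , u , b , u∉ , b∈ , lt = ⇛⁻ x y m in
      □-zip (λ w u∉ b∈ → ⇛⁺ (f w) (g w) p<1 u∉ b∈ lt) (∉⁻ t u∉) (∈⁻ s b∈)
    from : ∀ {p} → □ (λ w → p ∈ lower (val (f w ⇛ g w))) → p ∈ lower (val (x ⇛ y))
    from {p} m =
      -- `h` splits the slack above `p` between an upper bound of `x` and a lower bound of `y`.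
      let q , p<q , q∈ = open□ (λ w → f w ⇛ g w) st m
          h , p<h , h<q = ℚₚ.<-dense p<q
          α , α∈ , α+η∉ = approx (val x) (<⇒0<- p<h)
          β , β∈ , β+η∉ = approx (val y) (<⇒0<- h<q)
      in ⇛⁺ x y (□-extract (□-map (λ w p∈ → val≤1 (f w ⇛ g w) p∈) m)) α+η∉ β∈ (□-extract
           (□-zip (λ w (α∈ , β+η∉) q∈ →
               let _ , u , b , u∉ , b∈ , lt = ⇛⁻ (f w) (g w) q∈
               in <-diff (lt +< below-outside (val (f w)) α∈ u∉ +< below-outside (val (g w)) b∈ β+η∉)
                    (solve 7 (λ p q h α β u b → con 1ℚ :+ β :- (p :+ (α :+ (h :- p))) :=
                       con 1ℚ :+ b :+ u :+ (β :+ (q :- h)) :- (q :+ u :+ α :+ b)) refl p q h α β u b))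
             (□-zip (λ w → _,_) (∈⁻ t α∈) (∉⁻ s β+η∉)) q∈))

  -- Induction on `φ`, the fragment being closed under subformulas. For suprema, the witnesses
  -- provided by `Forced` give the passage from the worlds to the model.
  truth : ∀ {k} (φ : Formula S k) → φ ∈ formulas k → ∀ as →
          eval model φ as tracks (λ w → eval (str w) φ (⟪ as ⟫* w))
  truth (distF s t) φ∈ as = tracks-resp (□-zip (λ w s≡ t≡ → ≈-reflexive (cong₂ (dist (str w)) s≡ t≡))
      (term-tracks as s) (term-tracks as t))
    (distP-tracks (evalTerm model as s) (evalTerm model as t))
  truth (predF P ts) φ∈ as = tracks-resp (□-map (λ w eq → ≈-reflexive (cong (predI (str w) P) eq)) (terms-track as ts))
    (predP-tracks P (evalTerms model as ts))
  truth (const q) φ∈ as = record { ∈⁺ = □-extract ; ∈⁻ = λ m → □-pure (λ w → m) ; ∉⁻ = λ m → □-pure (λ w → m) }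
  truth (φ ⇒ ψ) φ∈ as = ⇛-tracks (settled-at φ∈ as) (truth φ (⇒-subˡ φ∈) as) (truth ψ (⇒-subʳ φ∈) as)
  truth (supX φ) φ∈ as = tracks-intro {eval model (supX φ) as} (settled-at φ∈ as) from to
    where
    to : ∀ {p} → p ∈ lower (val (eval model (supX φ) as)) →
         □ (λ w → p ∈ lower (val (eval (str w) (supX φ) (⟪ as ⟫* w))))
    to (inj₁ p<0)     = □-pure (λ w → inj₁ p<0)
    to (inj₂ (a , m)) = □-map (λ w p∈ → inj₂ (⟪ a ⟫ w , p∈)) (∈⁻ (truth φ (supX-sub φ∈) (a ∷ as)) m)
    from : ∀ {p} → □ (λ w → p ∈ lower (val (eval (str w) (supX φ) (⟪ as ⟫* w)))) →
           p ∈ lower (val (eval model (supX φ) as))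
    from {p} m with common-points as
    ... | n , ts , eq
      with forced (subst-closed ts φ∈) (□-map (λ w p∈ →
             proj₂ (subst (λ bs → val (ev (substFormula ts (supX φ)) w) ≈ val (eval (str w) (supX φ) bs))
                      (eq w)
               (eval-subst (str w) ts (supX φ) _)) p∈) m)
    ... | q , p<q , j , inj₂ q<0 = inj₁ (ℚₚ.<-trans p<q q<0)
    ... | q , p<q , j , inj₁ (x , f) =
      -- The forced witness is a term; its canonical representative is a point of the model.
      let a , a∼x = canonical x
      in inj₂ (a , ∈⁺ (truth φ (supX-sub φ∈) (a ∷ as)) (□-zip (λ w eqx q∈ →
           downClosed (val (eval (str w) φ (⟪ a ∷ as ⟫* w))) (ℚₚ.<⇒≤ p<q)
             (subst (λ bs → q ∈ lower (val (eval (str w) φ bs)))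
               (cong₂ _∷_ (sym eqx) (trans (evalTerms-map-weaken (str w) _ _ ts) (eq w)))
               (proj₁ (eval-subst (str w) (var zero ∷ map (renameTerm suc) ts) φ _) q∈)))
           a∼x (j , f)))
  truth (supN φs) φ∈ as = tracks-intro {eval model (supN φs) as} (settled-at φ∈ as) from to
    where
    to : ∀ {p} → p ∈ lower (val (eval model (supN φs) as)) →
         □ (λ w → p ∈ lower (val (eval (str w) (supN φs) (⟪ as ⟫* w))))
    to (inj₁ p<0)     = □-pure (λ w → inj₁ p<0)
    to (inj₂ (k , m)) = □-map (λ w p∈ → inj₂ (k , p∈)) (∈⁻ (truth (φs k) (supN-sub φ∈ k) as) m)
    from : ∀ {p} → □ (λ w → p ∈ lower (val (eval (str w) (supN φs) (⟪ as ⟫* w)))) →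
           p ∈ lower (val (eval model (supN φs) as))
    from {p} m with common-points as
    ... | n , ts , eq
      with forced (subst-closed ts φ∈) (□-map (λ w p∈ →
             proj₂ (subst (λ bs → val (ev (substFormula ts (supN φs)) w) ≈ val (eval (str w) (supN φs) bs))
                      (eq w)
               (eval-subst (str w) ts (supN φs) _)) p∈) m)
    ... | q , p<q , j , inj₂ q<0 = inj₁ (ℚₚ.<-trans p<q q<0)
    ... | q , p<q , j , inj₁ (k , f) =
      inj₂ (k , ∈⁺ (truth (φs k) (supN-sub φ∈ k) as) (j , λ w m →
        downClosed (val (eval (str w) (φs k) (⟪ as ⟫* w))) (ℚₚ.<⇒≤ p<q)
          (subst (λ bs → q ∈ lower (val (eval (str w) (φs k) bs))) (eq w)
            (proj₁ (eval-subst (str w) ts (φs k) _) (f w m)))))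

  -- The generic model satisfies the theory and omits the types

  model⊨T : IsTheory L T → IsModel model T
  model⊨T T⊆L {φ} φ∈ = val≤1 (eval model φ []) , λ p<1 →
    ∈⁺ (truth φ (T⊆L φ∈) []) (□-pure (λ w → proj₂ (isModel w φ∈) p<1))

  -- Terms `ts` name the points, and the requirement for the code of `ts` forces some `σ` of the
  -- type to stay at or below some `q < 1`, whereas a realization would give it the value 1.
  omits : ∀ i as → ¬ Realizes model (Σs i) as
  omits i as real =
    let n , ts , eq = common-points as
        k , e = proj₂ (countable n) (encode∈L ts)
        j , req = generic (suc i) n k
        σ , lift σ∈ , q , q<1 , q∉ = req e
    in □-extract (□-zip (λ w q∉ q∈ → q∉ (subst (λ bs → q ∈ lower (val (eval (str w) σ bs))) (sym (eq w)) q∈))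
         (j , q∉) (∈⁻ (truth σ (Σs⊆L i σ∈) as) (proj₂ (real σ∈) q<1)))

theoremA : ExcludedMiddle (lsuc 0ℓ) →
    (S : Signature) (L : Fragment S) → Countable L →
    (T : Pred (Formula S 0) 0ℓ) → IsTheory L T →
    (arity : ℕ → ℕ) (Σs : ∀ n → Pred (Formula S (arity n)) 0ℓ) →
    (∀ n → IsType L T (Σs n)) →
    (∀ n → ¬ Principal L T (Σs n)) →
    Σ[ 𝓜 ∈ Structure S ] (IsModel 𝓜 T × (∀ n as → ¬ Realizes 𝓜 (Σs n) as))
theoremA em S L countable T T⊆L arity Σs types ¬principal = G.model , G.model⊨T T⊆L , G.omits
  where
  -- The structure realizing `Σs 0` provides the model of `T` in which the chain starts; the
  -- assignment is arbitrary.
  open IsType (types 0)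
  w₀ : Forcing.World em L T
  w₀ = record { str = model ; isModel = isModel ; env = λ _ → Structure.nonempty model }
  module G = Generic em L countable T arity Σs (λ n → IsType.isSubset (types n)) ¬principal w₀
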